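{- Let $q$ be an odd prime power, let $d$ be odd, and let $i \in \{3,4\}$. Let $R \subseteq \mathbb{F}_q^\times$ be such that $(-1)^{i+1}\eta(-r) = -1$ for every $r \in R$. Let $P \subseteq \mathbb{F}_q^d$, and let $S$ be a set of $Q_i^d$-spheres whose radii all lie in $R$. Then \[\left|I(P,S) - q^{ -1}|P|\,|S|\right| \leq q^{(d-1)/2}|P|^{1/2}|S|^{1/2} + \sqrt{3}\,q^{(d-3)/4}|P|^{1/2}|S|.\]
   Context: $\mathbb{F}_q$ is the finite field with $q$ elements, $\mathbb{F}_q^\times = \mathbb{F}_q\setminus\{0\}$, and $\eta$ is the quadratic character: $\eta(0)=0$, $\eta(x)=1$ if $x$ is a non-zero square, $\eta(x)=-1$ if $x$ is a non-square. Fix a non-square $\epsilon\in\mathbb{F}_q$. For odd $d$, define quadratic forms on $\mathbb{F}_q^d$ by $Q_3^d(x) = x_1x_2 + x_3x_4 + \cdots + x_{d-2}x_{d-1} - x_d^2$ and $Q_4^d(x) = x_1x_2 + x_3x_4 + \cdots + x_{d-2}x_{d-1} - \epsilon x_d^2$. For a quadratic form $Q$, the $Q$-sphere with center $y$ and radius $r$ is $\{x \in \mathbb{F}_q^d : Q(x-y) = r\}$; a sphere is specified by its center and radius. For $P \subseteq \mathbb{F}_q^d$ and a set $S$ of spheres, $I(P,S) = \#\{(x,s) \in P \times S : x \in s\}$. -}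

module Defs where

open import Level using (0ℓ)
open import Data.Nat as ℕ using (ℕ; suc; _%_; _*_; _^_)
open import Data.Integer as ℤ using (ℤ; +_; -[1+_])
open import Data.Rational as ℚ using (ℚ; _/_)
open import Data.List as List using (List; []; _∷_; length; cartesianProduct)
open import Data.List.Membership.Propositional using (_∈_)
open import Data.List.Relation.Unary.Any using (Any; here; there; any?)
open import Data.List.Relation.Unary.Unique.Propositional using (Unique)
open import Data.Vec as Vec using (Vec; zipWith; init; last; toList)
open import Data.Product using (_×_; _,_; proj₁; proj₂)
open import Relation.Nullary using (¬_; Dec; yes; no)
open import Relation.Binary.PropositionalEquality using (_≡_; _≢_)
open import Relation.Binary.Definitions using (DecidableEquality)
open import Algebra.Structures using (IsCommutativeRing)

record FiniteField : Set₁ where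
  infixl 6 _+_
  infixl 7 _*F_
  field
    Carrier  : Set
    _+_      : Carrier → Carrier → Carrier
    _*F_     : Carrier → Carrier → Carrier
    -F_      : Carrier → Carrier
    0F 1F    : Carrier
    isCommutativeRing : IsCommutativeRing _≡_ _+_ _*F_ -F_ 0F 1F
    0≢1      : 0F ≢ 1F
    inverse  : ∀ x → x ≢ 0F → Data.Product.Σ Carrier (λ y → x *F y ≡ 1F)
    _≟_      : DecidableEquality Carrier
    elems    : List Carrier
    elems-unique   : Unique elems
    elems-complete : ∀ x → x ∈ elems

  _-F_ : Carrier → Carrier → Carrier
  x -F y = x + (-F y)

  size : ℕ
  size = length elems

  instance
    size-nonZero : ℕ.NonZero size
    size-nonZero = nz (elems-complete 0F)
      where
      nz : ∀ {x : Carrier} {xs} → x ∈ xs → ℕ.NonZero (length xs)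
      nz {xs = _ ∷ _} _ = record { nonZero = _ }

  IsSquare : Carrier → Set
  IsSquare x = Any (λ y → y *F y ≡ x) elems

  isSquare? : ∀ x → Dec (IsSquare x)
  isSquare? x = any? (λ y → (y *F y) ≟ x) elems

  η : Carrier → ℤ
  η x with x ≟ 0F
  ... | yes _ = + 0
  ... | no _ with isSquare? x
  ...   | yes _ = + 1
  ...   | no _  = -[1+ 0 ]

  hyp : List Carrier → Carrier
  hyp (a ∷ b ∷ rest) = a *F b + hyp rest
  hyp _              = 0F

  _-V_ : ∀ {d} → Vec Carrier d → Vec Carrier d → Vec Carrier d
  _-V_ = zipWith _-F_

data QIndex : Set where
  i3 i4 : QIndex

module _ (F : FiniteField) where
  open FiniteField F

  -- Q_i^d for d = 2m+1, with ε the fixed non-square: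
  -- Q_3^d(x) = x₁x₂ + … + x_{d-2}x_{d-1} - x_d², Q_4^d(x) = … - ε x_d²
  Q : (ε : Carrier) (i : QIndex) {m : ℕ} → Vec Carrier (suc (2 * m)) → Carrier
  Q ε i3 x = hyp (toList (init x)) -F (last x *F last x)
  Q ε i4 x = hyp (toList (init x)) -F (ε *F (last x *F last x))

  signI : QIndex → ℤ
  signI i3 = + 1
  signI i4 = -[1+ 0 ]

  -- A sphere is given by its centre and radius.
  Sphere : ℕ → Set
  Sphere m = Vec Carrier (suc (2 * m)) × Carrier

  incidences : (ε : Carrier) (i : QIndex) (m : ℕ) →
               List (Vec Carrier (suc (2 * m))) → List (Sphere m) → ℕ
  incidences ε i m P S = length (List.filter inc? (cartesianProduct {A = Vec Carrier (suc (2 * m))} {B = Sphere m} P S))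
    where
    inc? : (p : Vec Carrier (suc (2 * m)) × Sphere m) →
           Dec (Q ε i {m} (proj₁ p -V proj₁ (proj₂ p)) ≡ proj₂ (proj₂ p))
    inc? (x , y , r) = Q ε i {m} (x -V y) ≟ r

ℕ→ℚ : ℕ → ℚ
ℕ→ℚ n = + n / 1

{-# OPTIONS --safe #-}
-- The variance Σ_x (Σ_{s ∈ S} (1[x ∈ s] - 1/q))² over all points x controls the discrepancy by
-- Cauchy–Schwarz, and expands into the sizes of the spheres and of their pairwise intersections.  Write the
-- form as m hyperbolic planes plus -c t².  The condition on a radius r says that r + c t² has no zero;
-- then a sphere has exactly q^{2m} - q^m points, and two distinct spheres meet in at most
-- q^{2m-1} + q^{m-1} points.  Indeed two spheres with different centres meet in a hyperplane section of one
-- of them.  An isometry makes the hyperplane's linear form vanish on an isotropic vector of a hyperbolic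
-- plane, which is then split off; the only exception is a plane section of a three-dimensional quadric,
-- a conic containing no line, whose points inject into the q + 1 slopes at one of them.
module Submission where

open import Defs
open import Algebra.Bundles using (CommutativeRing)
import Algebra.Solver.Ring
open import Algebra.Solver.Ring.AlmostCommutativeRing using (fromCommutativeRing; _-Raw-AlmostCommutative⟶_)
open import Data.Empty using (⊥)
open import Data.Integer as ℤ using (ℤ; +_; -[1+_]; 0ℤ; 1ℤ)
import Data.Integer.Properties as ℤₚ
open import Data.Integer.Solver using (module +-*-Solver)
open import Data.List using (List; []; _∷_; _++_; length; map; filter; cartesianProduct)
open import Data.List.Membership.Propositional using (_∈_; lose)
open import Data.List.Membership.Propositional.Properties using (∈-cartesianProduct⁺; ∈-map⁺; ∈-map⁻)
import Data.List.Properties as Listₚ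
open import Data.List.Relation.Unary.All as All using (All; []; _∷_)
import Data.List.Relation.Unary.All.Properties as Allₚ
open import Data.List.Relation.Unary.AllPairs using ([]; _∷_)
open import Data.List.Relation.Unary.Any using (here; there; satisfied)
open import Data.List.Relation.Unary.Unique.Propositional using (Unique)
import Data.List.Relation.Unary.Unique.Propositional.Properties as Uniqueₚ
open import Data.Maybe using (Maybe; just; nothing)
import Data.Maybe.Properties as Maybeₚ
open import Data.Nat as ℕ using (ℕ; zero; suc)
import Data.Nat.Properties as ℕₚ
open import Data.Product using (∃; _×_; _,_; proj₁; proj₂)
open import Data.Product.Properties using (≡-dec; ,-injective)
open import Data.Rational as ℚ using (ℚ; 0ℚ; toℚᵘ)
import Data.Rational.Properties as ℚₚ
import Data.Rational.Solver
import Data.Rational.Unnormalised as ℚᵘ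
import Data.Rational.Unnormalised.Properties as ℚᵘₚ
open import Data.Sum using (_⊎_; inj₁; inj₂)
open import Data.Vec using (Vec; []; _∷_; init; last; toList)
open import Function using (_∘_)
open import Relation.Binary.Definitions using (DecidableEquality)
import Relation.Binary.PropositionalEquality as ≡
open import Relation.Nullary using (¬_; Dec; yes; no; contradiction; _×-dec_)
open import Relation.Nullary.Decidable using (map′)
open import Relation.Unary using (Decidable)

-- The sign in the radius condition is what makes the intersection bound true. Each sphere then has
-- fewer points than the average q^(2m), and this deficit keeps tangent hyperplane sections small.
-- For the opposite sign a tangent plane in dimension three can cut out two crossing lines, which
-- have 2q - 1 points where q + 1 are allowed. Dimension three is exceptional because the kernel of
-- the linear form is then only a plane, which may be anisotropic. From dimension five on the kernel
-- always contains an isotropic vector, so a hyperbolic plane can be split off compatibly with the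
-- form. Counts stay in the integers: deviations from the mean are multiplied by q, and so is the
-- intersection bound. The two square roots of the final estimate are replaced by arbitrary
-- non-negative rationals whose squares dominate the radicands; letting these decrease recovers the
-- real inequality.

-- Integer coefficients for ring identities in an abstract commutative ring.

module IntegerCoefficients {c ℓ} (R : CommutativeRing c ℓ) where
  open CommutativeRing R
  open import Algebra.Properties.Ring ring
  open import Algebra.Properties.AbelianGroup +-abelianGroup using (⁻¹-∙-comm)
  open import Algebra.Properties.Semiring.Mult semiring renaming (_×_ to _·_)
  open import Relation.Binary.Reasoning.Setoid setoid

  ⟦_⟧ : ℤ → Carrier
  ⟦ + n ⟧      = n · 1#
  ⟦ -[1+ n ] ⟧ = - (suc n · 1#)

  ⟦⊖⟧ : ∀ m n → ⟦ m ℤ.⊖ n ⟧ ≈ m · 1# + - (n · 1#)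
  ⟦⊖⟧ m       zero    = sym (trans (+-congˡ -0#≈0#) (+-identityʳ _))
  ⟦⊖⟧ zero    (suc n) = sym (+-identityˡ _)
  ⟦⊖⟧ (suc m) (suc n) = begin
    ⟦ suc m ℤ.⊖ suc n ⟧                    ≡⟨ ≡.cong ⟦_⟧ (ℤₚ.[1+m]⊖[1+n]≡m⊖n m n) ⟩
    ⟦ m ℤ.⊖ n ⟧                            ≈⟨ ⟦⊖⟧ m n ⟩
    m · 1# + - (n · 1#)                    ≈⟨ +-congʳ (sym (+-identityˡ _)) ⟩
    (0# + m · 1#) + - (n · 1#)             ≈⟨ +-congʳ (+-congʳ (sym (-‿inverseʳ 1#))) ⟩
    ((1# + - 1#) + m · 1#) + - (n · 1#)    ≈⟨ +-congʳ (+-assoc _ _ _) ⟩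
    (1# + (- 1# + m · 1#)) + - (n · 1#)    ≈⟨ +-congʳ (+-congˡ (+-comm _ _)) ⟩
    (1# + (m · 1# + - 1#)) + - (n · 1#)    ≈⟨ +-congʳ (sym (+-assoc _ _ _)) ⟩
    (suc m · 1# + - 1#) + - (n · 1#)       ≈⟨ +-assoc _ _ _ ⟩
    suc m · 1# + (- 1# + - (n · 1#))       ≈⟨ +-congˡ (⁻¹-∙-comm _ _) ⟩
    suc m · 1# + - (suc n · 1#)            ∎

  +-homo : ∀ i j → ⟦ i ℤ.+ j ⟧ ≈ ⟦ i ⟧ + ⟦ j ⟧
  +-homo (+ m)    (+ n)    = ×-homo-+ 1# m n
  +-homo (+ m)    -[1+ n ] = ⟦⊖⟧ m (suc n)
  +-homo -[1+ m ] (+ n)    = trans (⟦⊖⟧ n (suc m)) (+-comm _ _)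
  +-homo -[1+ m ] -[1+ n ] = begin
    - (suc (suc (m ℕ.+ n)) · 1#)      ≡⟨ ≡.cong (λ k → - (suc k · 1#)) (≡.sym (ℕₚ.+-suc m n)) ⟩
    - ((suc m ℕ.+ suc n) · 1#)        ≈⟨ -‿cong (×-homo-+ 1# (suc m) (suc n)) ⟩
    - (suc m · 1# + suc n · 1#)       ≈⟨ sym (⁻¹-∙-comm _ _) ⟩
    - (suc m · 1#) + - (suc n · 1#)   ∎

  -‿homo : ∀ i → ⟦ ℤ.- i ⟧ ≈ - ⟦ i ⟧
  -‿homo (+ zero)  = sym -0#≈0#
  -‿homo (+ suc n) = refl
  -‿homo -[1+ n ]  = sym (-‿involutive _)

  *-homo-+ : ∀ m j → ⟦ + m ℤ.* j ⟧ ≈ m · 1# * ⟦ j ⟧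
  *-homo-+ m (+ n)    = begin
    ⟦ + m ℤ.* + n ⟧     ≡⟨ ≡.cong ⟦_⟧ (≡.sym (ℤₚ.pos-* m n)) ⟩
    (m ℕ.* n) · 1#      ≈⟨ ×1-homo-* m n ⟩
    m · 1# * (n · 1#)   ∎
  *-homo-+ m -[1+ n ] = begin
    ⟦ + m ℤ.* ℤ.- (+ suc n) ⟧    ≡⟨ ≡.cong ⟦_⟧ (≡.sym (ℤₚ.neg-distribʳ-* (+ m) (+ suc n))) ⟩
    ⟦ ℤ.- (+ m ℤ.* + suc n) ⟧    ≈⟨ -‿homo (+ m ℤ.* + suc n) ⟩
    - ⟦ + m ℤ.* + suc n ⟧        ≈⟨ -‿cong (*-homo-+ m (+ suc n)) ⟩
    - (m · 1# * (suc n · 1#))    ≈⟨ -‿distribʳ-* _ _ ⟩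
    m · 1# * - (suc n · 1#)      ∎

  *-homo : ∀ i j → ⟦ i ℤ.* j ⟧ ≈ ⟦ i ⟧ * ⟦ j ⟧
  *-homo (+ m)    j = *-homo-+ m j
  *-homo -[1+ m ] j = begin
    ⟦ ℤ.- (+ suc m) ℤ.* j ⟧    ≡⟨ ≡.cong ⟦_⟧ (≡.sym (ℤₚ.neg-distribˡ-* (+ suc m) j)) ⟩
    ⟦ ℤ.- (+ suc m ℤ.* j) ⟧    ≈⟨ -‿homo (+ suc m ℤ.* j) ⟩
    - ⟦ + suc m ℤ.* j ⟧        ≈⟨ -‿cong (*-homo-+ (suc m) j) ⟩
    - (suc m · 1# * ⟦ j ⟧)     ≈⟨ -‿distribˡ-* _ _ ⟩
    - (suc m · 1#) * ⟦ j ⟧     ∎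

  morphism : CommutativeRing.rawRing ℤₚ.+-*-commutativeRing -Raw-AlmostCommutative⟶ fromCommutativeRing R
  morphism = record
    { ⟦_⟧    = ⟦_⟧
    ; +-homo = +-homo
    ; *-homo = *-homo
    ; -‿homo = -‿homo
    ; 0-homo = refl
    ; 1-homo = +-identityʳ 1#
    }

  -- Distinct integers may have equal images in positive characteristic. Answering `nothing` for
  -- them is sound and only forgoes cancellations special to that characteristic.
  coeff≟ : ∀ i j → Maybe (⟦ i ⟧ ≈ ⟦ j ⟧)
  coeff≟ i j with i ℤ.≟ j
  ... | yes ≡.refl = just refl
  ... | no _       = nothing

  module Solver = Algebra.Solver.Ring (CommutativeRing.rawRing ℤₚ.+-*-commutativeRing) (fromCommutativeRing R) morphism coeff≟

open import Relation.Binary.PropositionalEquality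

-- Finite sums of integers over lists, and indicator functions.

module FiniteSums where
  open import Data.Integer using (_+_; _*_; _-_; -_; _≤_)
  open +-*-Solver using (solve; _:=_; con) renaming (_:+_ to _⊕_; _:*_ to _⊗_; _:-_ to _⊝_; :-_ to ⊝_)

  private variable
    A B : Set

  ∑ : List A → (A → ℤ) → ℤ
  ∑ []       f = 0ℤ
  ∑ (x ∷ xs) f = f x + ∑ xs f

  ∑-syntax = ∑
  infix 5 ∑-syntax
  syntax ∑-syntax xs (λ x → e) = ∑[ x ∈ xs ] e

  ∑-cong : ∀ (xs : List A) {f g} → (∀ x → f x ≡ g x) → ∑ xs f ≡ ∑ xs g
  ∑-cong []       f≗g = refl
  ∑-cong (x ∷ xs) f≗g = cong₂ _+_ (f≗g x) (∑-cong xs f≗g)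

  ∑-mono-∈ : ∀ (xs : List A) {f g} → (∀ x → x ∈ xs → f x ≤ g x) → ∑ xs f ≤ ∑ xs g
  ∑-mono-∈ []       f≤g = ℤₚ.≤-refl
  ∑-mono-∈ (x ∷ xs) f≤g = ℤₚ.+-mono-≤ (f≤g x (here refl)) (∑-mono-∈ xs (λ y y∈ → f≤g y (there y∈)))

  ∑-mono : ∀ (xs : List A) {f g} → (∀ x → f x ≤ g x) → ∑ xs f ≤ ∑ xs g
  ∑-mono xs f≤g = ∑-mono-∈ xs (λ x _ → f≤g x)

  ∑-const : ∀ (xs : List A) k → ∑[ _ ∈ xs ] k ≡ + length xs * k
  ∑-const []       k = sym (ℤₚ.*-zeroˡ k)
  ∑-const (x ∷ xs) k = trans (cong (_+_ k) (∑-const xs k)) (sym (ℤₚ.suc-* (+ length xs) k))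

  ∑-zero : ∀ (xs : List A) → ∑[ _ ∈ xs ] 0ℤ ≡ 0ℤ
  ∑-zero xs = trans (∑-const xs 0ℤ) (ℤₚ.*-zeroʳ (+ length xs))

  ∑-nonNeg : ∀ (xs : List A) {f} → (∀ x → 0ℤ ≤ f x) → 0ℤ ≤ ∑ xs f
  ∑-nonNeg xs {f} 0≤f = subst (_≤ ∑ xs f) (∑-zero xs) (∑-mono xs 0≤f)

  ∑-+ : ∀ (xs : List A) f g → ∑[ x ∈ xs ] (f x + g x) ≡ ∑ xs f + ∑ xs g
  ∑-+ []       f g = refl
  ∑-+ (x ∷ xs) f g = trans (cong (_+_ (f x + g x)) (∑-+ xs f g))
    (solve 4 (λ a b c d → a ⊕ b ⊕ (c ⊕ d) := a ⊕ c ⊕ (b ⊕ d)) refl (f x) (g x) (∑ xs f) (∑ xs g))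

  ∑-*ˡ : ∀ (xs : List A) k f → ∑[ x ∈ xs ] (k * f x) ≡ k * ∑ xs f
  ∑-*ˡ []       k f = sym (ℤₚ.*-zeroʳ k)
  ∑-*ˡ (x ∷ xs) k f = trans (cong (_+_ (k * f x)) (∑-*ˡ xs k f)) (sym (ℤₚ.*-distribˡ-+ k _ _))

  ∑-*ʳ : ∀ (xs : List A) f k → ∑[ x ∈ xs ] (f x * k) ≡ ∑ xs f * k
  ∑-*ʳ xs f k = trans (∑-cong xs (λ x → ℤₚ.*-comm (f x) k)) (trans (∑-*ˡ xs k f) (ℤₚ.*-comm k _))

  ∑-- : ∀ (xs : List A) f g → ∑[ x ∈ xs ] (f x - g x) ≡ ∑ xs f - ∑ xs g
  ∑-- []       f g = refl
  ∑-- (x ∷ xs) f g = trans (cong (_+_ (f x - g x)) (∑-- xs f g))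
    (solve 4 (λ a b c d → a ⊝ b ⊕ (c ⊝ d) := a ⊕ c ⊝ (b ⊕ d)) refl (f x) (g x) (∑ xs f) (∑ xs g))

  ∑-swap : ∀ (xs : List A) (ys : List B) (f : A → B → ℤ) →
           ∑[ x ∈ xs ] ∑[ y ∈ ys ] f x y ≡ ∑[ y ∈ ys ] ∑[ x ∈ xs ] f x y
  ∑-swap []       ys f = sym (∑-zero ys)
  ∑-swap (x ∷ xs) ys f = trans (cong (_+_ (∑ ys (f x))) (∑-swap xs ys f))
    (sym (∑-+ ys (f x) (λ y → ∑ xs (λ x′ → f x′ y))))

  ∑-++ : ∀ (xs ys : List A) f → ∑ (xs ++ ys) f ≡ ∑ xs f + ∑ ys f
  ∑-++ []       ys f = sym (ℤₚ.+-identityˡ _)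
  ∑-++ (x ∷ xs) ys f = trans (cong (_+_ (f x)) (∑-++ xs ys f)) (sym (ℤₚ.+-assoc (f x) _ _))

  ∑-map : ∀ (h : A → B) xs f → ∑ (map h xs) f ≡ ∑ xs (f ∘ h)
  ∑-map h []       f = refl
  ∑-map h (x ∷ xs) f = cong (_+_ (f (h x))) (∑-map h xs f)

  ∑-cartesianProduct : ∀ (xs : List A) (ys : List B) f →
    ∑ (cartesianProduct xs ys) f ≡ ∑[ x ∈ xs ] ∑[ y ∈ ys ] f (x , y)
  ∑-cartesianProduct []       ys f = refl
  ∑-cartesianProduct (x ∷ xs) ys f = trans (∑-++ (map (x ,_) ys) _ f)
    (cong₂ _+_ (∑-map (x ,_) ys f) (∑-cartesianProduct xs ys f))

  ∑-*-∑ : ∀ (xs : List A) (ys : List B) (f : A → ℤ) (g : B → ℤ) →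
          ∑ xs f * ∑ ys g ≡ ∑[ x ∈ xs ] ∑[ y ∈ ys ] f x * g y
  ∑-*-∑ xs ys f g = trans (sym (∑-*ʳ xs f (∑ ys g))) (∑-cong xs (λ x → sym (∑-*ˡ ys (f x) g)))

  0≤i² : ∀ i → 0ℤ ≤ i * i
  0≤i² (+ n)        = subst (0ℤ ≤_) (ℤₚ.pos-* n n) (ℤ.+≤+ ℕ.z≤n)
  0≤i² (ℤ.-[1+ n ]) = ℤ.+≤+ ℕ.z≤n

  -- Going from `xs` to `x ∷ xs` raises the difference of the two sides by exactly the sum of the
  -- squares of f x - f y over y in `xs`.
  cauchySchwarz : ∀ (xs : List A) f → ∑ xs f * ∑ xs f ≤ + length xs * (∑[ x ∈ xs ] f x * f x)
  cauchySchwarz []       f = ℤₚ.≤-refl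
  cauchySchwarz (x ∷ xs) f = ℤₚ.0≤i-j⇒j≤i (subst (0ℤ ≤_) eq (ℤₚ.+-mono-≤ (∑-nonNeg xs (λ y → 0≤i² (f x - f y))) (ℤₚ.i≤j⇒0≤j-i (cauchySchwarz xs f))))
    where
    n = + length xs
    a = f x
    G = ∑ xs f
    V = ∑[ y ∈ xs ] f y * f y
    variance : ∑[ y ∈ xs ] (a - f y) * (a - f y) ≡ n * (a * a) + (- (+ 2 * a) * G + V)
    variance = trans
      (∑-cong xs (λ y → solve 2 (λ a b → (a ⊝ b) ⊗ (a ⊝ b) := a ⊗ a ⊕ (⊝ (con (+ 2) ⊗ a) ⊗ b ⊕ b ⊗ b)) refl a (f y)))
      (trans (∑-+ xs _ _) (cong₂ _+_ (∑-const xs (a * a))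
        (trans (∑-+ xs _ _) (cong (_+ V) (∑-*ˡ xs (- (+ 2 * a)) f)))))
    eq : ∑ xs (λ y → (a - f y) * (a - f y)) + (n * V - G * G) ≡ + length (x ∷ xs) * (a * a + V) - (a + G) * (a + G)
    eq = trans (cong (_+ (n * V - G * G)) variance)
      (solve 4 (λ n a G V → n ⊗ (a ⊗ a) ⊕ (⊝ (con (+ 2) ⊗ a) ⊗ G ⊕ V) ⊕ (n ⊗ V ⊝ G ⊗ G)
        := (con 1ℤ ⊕ n) ⊗ (a ⊗ a ⊕ V) ⊝ (a ⊕ G) ⊗ (a ⊕ G)) refl n a G V)

  𝟙 : {P : Set} → Dec P → ℤ
  𝟙 (yes _) = 1ℤ
  𝟙 (no _)  = 0ℤ

  𝟙-yes : {P : Set} (P? : Dec P) → P → 𝟙 P? ≡ 1ℤ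
  𝟙-yes (yes _) _ = refl
  𝟙-yes (no ¬p) p = contradiction p ¬p

  𝟙-no : {P : Set} (P? : Dec P) → ¬ P → 𝟙 P? ≡ 0ℤ
  𝟙-no (yes p) ¬p = contradiction p ¬p
  𝟙-no (no _)  _  = refl

  𝟙-cong : {P Q : Set} → (P → Q) → (Q → P) → (P? : Dec P) (Q? : Dec Q) → 𝟙 P? ≡ 𝟙 Q?
  𝟙-cong to from (yes p) Q? = sym (𝟙-yes Q? (to p))
  𝟙-cong to from (no ¬p) Q? = sym (𝟙-no Q? (¬p ∘ from))

  𝟙-nonNeg : {P : Set} (P? : Dec P) → 0ℤ ≤ 𝟙 P?
  𝟙-nonNeg (yes _) = ℤ.+≤+ ℕ.z≤n
  𝟙-nonNeg (no _)  = ℤ.+≤+ ℕ.z≤n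

  𝟙-idem : {P : Set} (P? : Dec P) → 𝟙 P? * 𝟙 P? ≡ 𝟙 P?
  𝟙-idem (yes _) = refl
  𝟙-idem (no _)  = refl

  length-filter-∑ : {P : A → Set} (P? : Decidable P) (xs : List A) →
                    + length (filter P? xs) ≡ ∑[ x ∈ xs ] 𝟙 (P? x)
  length-filter-∑ P? []       = refl
  length-filter-∑ P? (x ∷ xs) with P? x
  ... | yes _ = cong (_+_ 1ℤ) (length-filter-∑ P? xs)
  ... | no _  = trans (length-filter-∑ P? xs) (sym (ℤₚ.+-identityˡ _))

  module _ (_≟_ : DecidableEquality A) where

    ∑-𝟙-∉ : ∀ {xs : List A} {x} → All (x ≢_) xs → ∀ (f : A → ℤ) → ∑[ y ∈ xs ] (𝟙 (x ≟ y) * f y) ≡ 0ℤ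
    ∑-𝟙-∉ []           f = refl
    ∑-𝟙-∉ {x = x} (_∷_ {y} x≢y x∉) f = cong₂ _+_ (cong (_* f y) (𝟙-no (x ≟ y) x≢y)) (∑-𝟙-∉ x∉ f)

    ∑-𝟙 : ∀ {xs : List A} {x} → Unique xs → x ∈ xs → ∀ (f : A → ℤ) → ∑[ y ∈ xs ] (𝟙 (x ≟ y) * f y) ≡ f x
    ∑-𝟙 {x = x} (x∉ ∷ _) (here refl) f = trans
      (cong₂ _+_ (trans (cong (_* f x) (𝟙-yes (x ≟ x) refl)) (ℤₚ.*-identityˡ (f x))) (∑-𝟙-∉ x∉ f))
      (ℤₚ.+-identityʳ (f x))
    ∑-𝟙 {x = x} (_∷_ {y} y∉ u) (there x∈) f = trans
      (cong₂ _+_ (cong (_* f y) (𝟙-no (x ≟ y) (λ x≡y → All.lookup y∉ x∈ (sym x≡y)))) (∑-𝟙 u x∈ f))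
      (ℤₚ.+-identityˡ (f x))

    ∑-𝟙-≤ : ∀ {xs : List A} x → Unique xs → ∀ (f : A → ℤ) → (∀ y → 0ℤ ≤ f y) → ∑[ y ∈ xs ] (𝟙 (y ≟ x) * f y) ≤ f x
    ∑-𝟙-≤ x []       f 0≤f = 0≤f x
    ∑-𝟙-≤ x (_∷_ {y} {ys} y∉ u) f 0≤f with y ≟ x
    ... | yes refl = ℤₚ.≤-reflexive (trans (cong₂ _+_ (ℤₚ.*-identityˡ (f y))
      (trans (∑-cong ys (λ z → cong (_* f z) (𝟙-cong sym sym (z ≟ y) (y ≟ z)))) (∑-𝟙-∉ y∉ f)))
      (ℤₚ.+-identityʳ (f y)))
    ... | no _ = subst (_≤ f x) (sym (ℤₚ.+-identityˡ _)) (∑-𝟙-≤ x u f 0≤f)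

    module _ {ys : List A} (ys! : Unique ys) (∈ys : ∀ x → x ∈ ys) where

      -- Both sums are compared through the pairs with x = y: every x in `xs` occurs exactly once in
      -- `ys`, while every y in `ys` occurs at most once in `xs`. The second count is only an
      -- inequality, hence the sign condition on `f`.
      ∑-⊆ : ∀ {xs} → Unique xs → ∀ (f : A → ℤ) → (∀ x → 0ℤ ≤ f x) → ∑ xs f ≤ ∑ ys f
      ∑-⊆ {xs} xs! f 0≤f = begin
        ∑ xs f                                   ≡⟨ ∑-cong xs (λ x → sym (∑-𝟙 ys! (∈ys x) f)) ⟩
        ∑[ x ∈ xs ] ∑[ y ∈ ys ] (𝟙 (x ≟ y) * f y) ≡⟨ ∑-swap xs ys _ ⟩
        ∑[ y ∈ ys ] ∑[ x ∈ xs ] (𝟙 (x ≟ y) * f y) ≤⟨ ∑-mono ys (λ y → ∑-𝟙-≤ y xs! (λ _ → f y) (λ _ → 0≤f y)) ⟩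
        ∑ ys f                                   ∎
        where open ℤₚ.≤-Reasoning

      length-⊆ : ∀ {xs} → Unique xs → length xs ℕ.≤ length ys
      length-⊆ {xs} xs! = ℤₚ.drop‿+≤+ (subst₂ _≤_ (card xs) (card ys) (∑-⊆ xs! (λ _ → 1ℤ) (λ _ → ℤ.+≤+ ℕ.z≤n)))
        where
        card : ∀ zs → ∑[ _ ∈ zs ] 1ℤ ≡ + length zs
        card zs = trans (∑-const zs 1ℤ) (ℤₚ.*-identityʳ _)

      ∑-bijection : (π π⁻¹ : A → A) → (∀ x → π⁻¹ (π x) ≡ x) → (∀ x → π (π⁻¹ x) ≡ x) →
                    ∀ (f : A → ℤ) → ∑[ x ∈ ys ] f (π x) ≡ ∑ ys f
      ∑-bijection π π⁻¹ invˡ invʳ f = begin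
        ∑[ x ∈ ys ] f (π x)                          ≡⟨ ∑-cong ys (λ x → sym (∑-𝟙 ys! (∈ys (π x)) f)) ⟩
        ∑[ x ∈ ys ] ∑[ y ∈ ys ] (𝟙 (π x ≟ y) * f y)   ≡⟨ ∑-swap ys ys _ ⟩
        ∑[ y ∈ ys ] ∑[ x ∈ ys ] (𝟙 (π x ≟ y) * f y)
          ≡⟨ ∑-cong ys (λ y → ∑-cong ys (λ x → cong (_* f y) (𝟙-cong (λ e → trans (cong π⁻¹ (sym e)) (invˡ x)) (λ e → trans (cong π (sym e)) (invʳ y)) (π x ≟ y) (π⁻¹ y ≟ x)))) ⟩
        ∑[ y ∈ ys ] ∑[ x ∈ ys ] (𝟙 (π⁻¹ y ≟ x) * f y) ≡⟨ ∑-cong ys (λ y → ∑-𝟙 ys! (∈ys (π⁻¹ y)) (λ _ → f y)) ⟩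
        ∑ ys f                                       ∎
        where open ≡-Reasoning

  diagonal : (_≟_ : DecidableEquality A) {xs : List A} → Unique xs →
             ∑[ x ∈ xs ] ∑[ y ∈ xs ] 𝟙 (x ≟ y) ≤ + length xs
  diagonal _≟_ {xs} xs! = begin
    ∑[ x ∈ xs ] ∑[ y ∈ xs ] 𝟙 (x ≟ y)        ≡⟨ ∑-swap xs xs _ ⟩
    ∑[ y ∈ xs ] ∑[ x ∈ xs ] 𝟙 (x ≟ y)        ≡⟨ ∑-cong xs (λ y → ∑-cong xs (λ x → sym (ℤₚ.*-identityʳ _))) ⟩
    ∑[ y ∈ xs ] ∑[ x ∈ xs ] (𝟙 (x ≟ y) * 1ℤ) ≤⟨ ∑-mono xs (λ y → ∑-𝟙-≤ _≟_ y xs! (λ _ → 1ℤ) (λ _ → ℤ.+≤+ ℕ.z≤n)) ⟩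
    ∑[ y ∈ xs ] 1ℤ                           ≡⟨ ∑-const xs 1ℤ ⟩
    + length xs * 1ℤ                         ≡⟨ ℤₚ.*-identityʳ _ ⟩
    + length xs                              ∎
    where open ℤₚ.≤-Reasoning

  𝟙-× : {P Q : Set} (P? : Dec P) (Q? : Dec Q) → 𝟙 (P? ×-dec Q?) ≡ 𝟙 P? ℤ.* 𝟙 Q?
  𝟙-× (yes _) (yes _) = refl
  𝟙-× (yes _) (no _)  = refl
  𝟙-× (no _)  (yes _) = refl
  𝟙-× (no _)  (no _)  = refl

open FiniteSums

-- Counting through an injective relation.

module _ {A B : Set} {D : A → Set} {R : A → B → Set} (image : ∀ x → D x → ∃ (R x))
         (injective : ∀ {x y} b → D x → D y → R x b → R y b → x ≡ y) where

  images : ∀ {xs} → All D xs → List B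
  images = All.reduce (λ {x} d → proj₁ (image x d))

  length-images : ∀ {xs} (ds : All D xs) → length (images ds) ≡ length xs
  length-images []       = refl
  length-images (_ ∷ ds) = cong suc (length-images ds)

  images-∌ : ∀ {x xs} (d : D x) (ds : All D xs) → All (x ≢_) xs → All (proj₁ (image x d) ≢_) (images ds)
  images-∌ d []       []          = []
  images-∌ {x} d (_∷_ {y} e ds) (x≢y ∷ x∉) =
    (λ b≡b′ → x≢y (injective _ d e (proj₂ (image x d)) (subst (R y) (sym b≡b′) (proj₂ (image y e))))) ∷ images-∌ d ds x∉

  images-unique : ∀ {xs} (ds : All D xs) → Unique xs → Unique (images ds)
  images-unique []       []         = []
  images-unique (d ∷ ds) (x∉ ∷ xs!) = images-∌ d ds x∉ ∷ images-unique ds xs!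

  -- The image is specified by a relation instead of a function, so that injectivity can be derived
  -- from the equations that an image satisfies, whatever case distinction produced it.
  length-⊆-image : DecidableEquality B → ∀ {ys} → Unique ys → (∀ b → b ∈ ys) →
                   ∀ {xs} → All D xs → Unique xs → length xs ℕ.≤ length ys
  length-⊆-image _≟_ {ys} ys! ∈ys ds xs! =
    subst (ℕ._≤ length ys) (length-images ds) (length-⊆ _≟_ ys! ∈ys (images-unique ds xs!))

-- Rational estimates that stand in for square roots.

module RationalBounds where
  open import Data.Rational using (_/_; ∣_∣)
  open Data.Rational.Solver.+-*-Solver using (solve; _:=_; _:+_; _:*_; _:-_)
  module ℤS = +-*-Solver

  ι : ℤ → ℚ
  ι i = i / 1

  toℚᵘ-/ : ∀ i k .{{_ : ℕ.NonZero k}} → toℚᵘ (i / k) ℚᵘ.≃ i ℚᵘ./ k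
  toℚᵘ-/ i (suc k) = ℚₚ.toℚᵘ-fromℚᵘ (ℚᵘ.mkℚᵘ i k)

  ι-homo-+ : ∀ i j → ι (i ℤ.+ j) ≡ ι i ℚ.+ ι j
  ι-homo-+ i j = ℚₚ.toℚᵘ-injective (begin-equality
    toℚᵘ (ι (i ℤ.+ j))             ≃⟨ toℚᵘ-/ (i ℤ.+ j) 1 ⟩
    (i ℤ.+ j) ℚᵘ./ 1
      ≃⟨ ℚᵘ.*≡* (ℤS.solve 2 (λ i j → (i ℤS.:+ j) ℤS.:* ℤS.con 1ℤ ℤS.:= (i ℤS.:* ℤS.con 1ℤ ℤS.:+ j ℤS.:* ℤS.con 1ℤ) ℤS.:* ℤS.con 1ℤ) refl i j) ⟩
    i ℚᵘ./ 1 ℚᵘ.+ j ℚᵘ./ 1         ≃⟨ ℚᵘₚ.+-cong (ℚᵘₚ.≃-sym (toℚᵘ-/ i 1)) (ℚᵘₚ.≃-sym (toℚᵘ-/ j 1)) ⟩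
    toℚᵘ (ι i) ℚᵘ.+ toℚᵘ (ι j)     ≃⟨ ℚᵘₚ.≃-sym (ℚₚ.toℚᵘ-homo-+ (ι i) (ι j)) ⟩
    toℚᵘ (ι i ℚ.+ ι j)             ∎)
    where open ℚᵘₚ.≤-Reasoning

  ι-homo-* : ∀ i j → ι (i ℤ.* j) ≡ ι i ℚ.* ι j
  ι-homo-* i j = ℚₚ.toℚᵘ-injective (begin-equality
    toℚᵘ (ι (i ℤ.* j))             ≃⟨ toℚᵘ-/ (i ℤ.* j) 1 ⟩
    i ℚᵘ./ 1 ℚᵘ.* (j ℚᵘ./ 1)       ≃⟨ ℚᵘₚ.*-cong (ℚᵘₚ.≃-sym (toℚᵘ-/ i 1)) (ℚᵘₚ.≃-sym (toℚᵘ-/ j 1)) ⟩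
    toℚᵘ (ι i) ℚᵘ.* toℚᵘ (ι j)     ≃⟨ ℚᵘₚ.≃-sym (ℚₚ.toℚᵘ-homo-* (ι i) (ι j)) ⟩
    toℚᵘ (ι i ℚ.* ι j)             ∎)
    where open ℚᵘₚ.≤-Reasoning

  ι-mono : ∀ {i j} → i ℤ.≤ j → ι i ℚ.≤ ι j
  ι-mono {i} {j} i≤j = ℚₚ.toℚᵘ-cancel-≤ (begin
    toℚᵘ (ι i)   ≃⟨ toℚᵘ-/ i 1 ⟩
    i ℚᵘ./ 1     ≤⟨ ℚᵘ.*≤* (ℤₚ.*-monoʳ-≤-nonNeg 1ℤ i≤j) ⟩
    j ℚᵘ./ 1     ≃⟨ ℚᵘₚ.≃-sym (toℚᵘ-/ j 1) ⟩
    toℚᵘ (ι j)   ∎)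
    where open ℚᵘₚ.≤-Reasoning

  i/k*k : ∀ i k .{{_ : ℕ.NonZero k}} → i / k ℚ.* ι (+ k) ≡ ι i
  i/k*k i k@(suc _) = ℚₚ.toℚᵘ-injective (begin-equality
    toℚᵘ (i / k ℚ.* ι (+ k))               ≃⟨ ℚₚ.toℚᵘ-homo-* (i / k) (ι (+ k)) ⟩
    toℚᵘ (i / k) ℚᵘ.* toℚᵘ (ι (+ k))       ≃⟨ ℚᵘₚ.*-cong (toℚᵘ-/ i k) (toℚᵘ-/ (+ k) 1) ⟩
    (i ℚᵘ./ k) ℚᵘ.* ((+ k) ℚᵘ./ 1)
      ≃⟨ ℚᵘ.*≡* (ℤS.solve 2 (λ i k → i ℤS.:* k ℤS.:* ℤS.con 1ℤ ℤS.:= i ℤS.:* (k ℤS.:* ℤS.con 1ℤ)) refl i (+ k)) ⟩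
    i ℚᵘ./ 1                               ≃⟨ ℚᵘₚ.≃-sym (toℚᵘ-/ i 1) ⟩
    toℚᵘ (ι i)                             ∎)
    where open ℚᵘₚ.≤-Reasoning

  ∣p∣²≡p² : ∀ p → ∣ p ∣ ℚ.* ∣ p ∣ ≡ p ℚ.* p
  ∣p∣²≡p² p with ℚₚ.∣p∣≡p∨∣p∣≡-p p
  ... | inj₁ e = cong₂ ℚ._*_ e e
  ... | inj₂ e = trans (cong₂ ℚ._*_ e e) (let open Data.Rational.Solver.+-*-Solver in
    solve 1 (λ p → (:- p) :* (:- p) := p :* p) refl p)

  p²≤q²⇒∣p∣≤q : ∀ p q → 0ℚ ℚ.≤ q → p ℚ.* p ℚ.≤ q ℚ.* q → ∣ p ∣ ℚ.≤ q
  p²≤q²⇒∣p∣≤q p q 0≤q p²≤q² with ∣ p ∣ ℚₚ.≤? q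
  ... | yes ∣p∣≤q = ∣p∣≤q
  ... | no ∣p∣≰q  = contradiction refl (λ e → ℚₚ.<-irrefl e (begin-strict
    q ℚ.* q             ≤⟨ ℚₚ.*-monoˡ-≤-nonNeg q {{ℚ.nonNegative 0≤q}} (ℚₚ.<⇒≤ q<∣p∣) ⟩
    q ℚ.* ∣ p ∣         <⟨ ℚₚ.*-monoˡ-<-pos ∣ p ∣ {{ℚ.positive (ℚₚ.≤-<-trans 0≤q q<∣p∣)}} q<∣p∣ ⟩
    ∣ p ∣ ℚ.* ∣ p ∣     ≡⟨ ∣p∣²≡p² p ⟩
    p ℚ.* p             ≤⟨ p²≤q² ⟩
    q ℚ.* q             ∎))
    where
    open ℚₚ.≤-Reasoning
    q<∣p∣ = ℚₚ.≰⇒> ∣p∣≰q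

  -- After multiplication by k² the hypothesis bounds the square of the discrepancy by a + b/k,
  -- hence by σ² + τ². Since στ is non-negative, this is at most (σ + τ)².
  discrepancy-bound : ∀ k .{{_ : ℕ.NonZero k}} (i j a b : ℤ) (σ τ : ℚ) → 0ℚ ℚ.≤ σ → 0ℚ ℚ.≤ τ →
    (+ k ℤ.* i ℤ.- j) ℤ.* (+ k ℤ.* i ℤ.- j) ℤ.≤ + k ℤ.* (+ k ℤ.* a) ℤ.+ + k ℤ.* b →
    ι a ℚ.≤ σ ℚ.* σ → b / k ℚ.≤ τ ℚ.* τ → ∣ ι i ℚ.- j / k ∣ ℚ.≤ σ ℚ.+ τ
  discrepancy-bound k@(suc k-1) i j a b σ τ 0≤σ 0≤τ D²≤ a≤σ² b≤τ² =
    p²≤q²⇒∣p∣≤q X (σ ℚ.+ τ) 0≤σ+τ (ℚₚ.*-cancelʳ-≤-pos K (ℚₚ.*-cancelʳ-≤-pos K (begin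
      X ℚ.* X ℚ.* K ℚ.* K
        ≡⟨ solve 2 (λ X K → X :* X :* K :* K := (X :* K) :* (X :* K)) refl X K ⟩
      (X ℚ.* K) ℚ.* (X ℚ.* K)                            ≡⟨ cong₂ ℚ._*_ XK XK ⟩
      ι D ℚ.* ι D                                        ≡⟨ sym (ι-homo-* D D) ⟩
      ι (D ℤ.* D)                                        ≤⟨ ι-mono D²≤ ⟩
      ι (+ k ℤ.* (+ k ℤ.* a) ℤ.+ + k ℤ.* b)              ≡⟨ ι-homo-+ (+ k ℤ.* (+ k ℤ.* a)) (+ k ℤ.* b) ⟩
      ι (+ k ℤ.* (+ k ℤ.* a)) ℚ.+ ι (+ k ℤ.* b)
        ≡⟨ cong₂ ℚ._+_ (trans (ι-homo-* (+ k) (+ k ℤ.* a)) (cong (K ℚ.*_) (ι-homo-* (+ k) a)))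
                                                              (trans (ι-homo-* (+ k) b) (cong (K ℚ.*_) (sym (i/k*k b k)))) ⟩
      K ℚ.* (K ℚ.* ι a) ℚ.+ K ℚ.* (b / k ℚ.* K)
        ≡⟨ solve 3 (λ K A B → K :* (K :* A) :+ K :* (B :* K) := (A :+ B) :* K :* K) refl K (ι a) (b / k) ⟩
      (ι a ℚ.+ b / k) ℚ.* K ℚ.* K                        ≤⟨ scale (scale (ℚₚ.+-mono-≤ a≤σ² b≤τ²)) ⟩
      (σ ℚ.* σ ℚ.+ τ ℚ.* τ) ℚ.* K ℚ.* K                  ≤⟨ scale (scale σ²+τ²≤) ⟩
      (σ ℚ.+ τ) ℚ.* (σ ℚ.+ τ) ℚ.* K ℚ.* K                ∎)))
    where
    open ℚₚ.≤-Reasoning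
    K = ι (+ k)
    X = ι i ℚ.- j / k
    D = + k ℤ.* i ℤ.- j
    instance
      K-pos : ℚ.Positive K
      K-pos = ℚₚ.normalize-pos k 1
      K-nonNeg : ℚ.NonNegative K
      K-nonNeg = ℚₚ.pos⇒nonNeg K
    scale : ∀ {p q} → p ℚ.≤ q → p ℚ.* K ℚ.≤ q ℚ.* K
    scale = ℚₚ.*-monoʳ-≤-nonNeg K
    XK : X ℚ.* K ≡ ι D
    XK = trans (solve 3 (λ I J K → (I :- J) :* K := K :* I :- J :* K) refl (ι i) (j / k) K)
      (trans (cong₂ ℚ._-_ (sym (ι-homo-* (+ k) i)) (i/k*k j k)) (move (ι-homo-+ D j)))
      where
      move : ι (D ℤ.+ j) ≡ ι D ℚ.+ ι j → ι (+ k ℤ.* i) ℚ.- ι j ≡ ι D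
      move e = trans (cong (λ z → ι z ℚ.- ι j) (ℤS.solve 2 (λ u v → u ℤS.:= u ℤS.:- v ℤS.:+ v) refl (+ k ℤ.* i) j))
        (trans (cong (ℚ._- ι j) e) (solve 2 (λ u v → u :+ v :- v := u) refl (ι D) (ι j)))
    0≤σ+τ : 0ℚ ℚ.≤ σ ℚ.+ τ
    0≤σ+τ = ℚₚ.+-mono-≤ 0≤σ 0≤τ
    στ-nonNeg : 0ℚ ℚ.≤ σ ℚ.* τ
    στ-nonNeg = subst (ℚ._≤ σ ℚ.* τ) (ℚₚ.*-zeroʳ σ) (ℚₚ.*-monoˡ-≤-nonNeg σ {{ℚ.nonNegative 0≤σ}} 0≤τ)
    σ²+τ²≤ : σ ℚ.* σ ℚ.+ τ ℚ.* τ ℚ.≤ (σ ℚ.+ τ) ℚ.* (σ ℚ.+ τ)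
    σ²+τ²≤ = subst₂ ℚ._≤_ (ℚₚ.+-identityʳ (σ ℚ.* σ ℚ.+ τ ℚ.* τ))
      (solve 2 (λ σ τ → σ :* σ :+ τ :* τ :+ (σ :* τ :+ σ :* τ) := (σ :+ τ) :* (σ :+ τ)) refl σ τ)
      (ℚₚ.+-monoʳ-≤ (σ ℚ.* σ ℚ.+ τ ℚ.* τ) (ℚₚ.+-mono-≤ στ-nonNeg στ-nonNeg))

open RationalBounds using (discrepancy-bound)

-- Polynomial identities in n = q and p = q^m.

module IntegerIdentities where
  open +-*-Solver

  square-scale : ∀ n p s → n ℤ.* (n ℤ.* ((p ℤ.* p) ℤ.* s)) ≡ (n ℤ.* p) ℤ.* (n ℤ.* p) ℤ.* s
  square-scale = solve 3 (λ n p s → n :* (n :* (p :* p :* s)) := (n :* p) :* (n :* p) :* s) refl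

  sphere-count-suc : ∀ n p → n ℤ.* (n ℤ.* (p ℤ.* p)) ℤ.- n ℤ.* (p ℤ.* p) ℤ.+ n ℤ.* (p ℤ.* p ℤ.- p) ≡
    (n ℤ.* p) ℤ.* (n ℤ.* p) ℤ.- n ℤ.* p
  sphere-count-suc = solve 2 (λ n p → n :* (n :* (p :* p)) :- n :* (p :* p) :+ n :* (p :* p :- p) :=
      (n :* p) :* (n :* p) :- n :* p) refl

  slice-nonZero : ∀ n p E → n ℤ.* (n ℤ.* (p ℤ.* p ℤ.* 1ℤ) ℤ.- p ℤ.* p ℤ.* 1ℤ ℤ.+ n ℤ.* E) ≡
                  n ℤ.* (n ℤ.* E) ℤ.+ (n ℤ.* (n ℤ.* (p ℤ.* p)) ℤ.- n ℤ.* (p ℤ.* p))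
  slice-nonZero = solve 3 (λ n p E → n :* (n :* (p :* p :* con 1ℤ) :- p :* p :* con 1ℤ :+ n :* E) :=
                  n :* (n :* E) :+ (n :* (n :* (p :* p)) :- n :* (p :* p))) refl

  slice-nonZero-bound : ∀ n p → n ℤ.* (p ℤ.* p ℤ.+ p) ℤ.+ (n ℤ.* (n ℤ.* (p ℤ.* p)) ℤ.- n ℤ.* (p ℤ.* p)) ≡
                  (n ℤ.* p) ℤ.* (n ℤ.* p) ℤ.+ n ℤ.* p
  slice-nonZero-bound = solve 2 (λ n p → n :* (p :* p :+ p) :+ (n :* (n :* (p :* p)) :- n :* (p :* p)) :=
                  (n :* p) :* (n :* p) :+ n :* p) refl

  slice-zero : ∀ n p e → n ℤ.* (n ℤ.* (p ℤ.* p) ℤ.- n ℤ.* (p ℤ.* p) ℤ.* e ℤ.+ n ℤ.* ((p ℤ.* p ℤ.- p) ℤ.* e)) ≡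
                 (n ℤ.* p) ℤ.* (n ℤ.* p) ℤ.+ n ℤ.* p ℤ.- (n ℤ.* p ℤ.+ n ℤ.* (n ℤ.* p) ℤ.* e)
  slice-zero = solve 3 (λ n p e → n :* (n :* (p :* p) :- n :* (p :* p) :* e :+ n :* ((p :* p :- p) :* e)) :=
                 (n :* p) :* (n :* p) :+ n :* p :- (n :* p :+ n :* (n :* p) :* e)) refl

  -- The factors `n ℤ.* 1ℤ` are the unfolded power n^1: this is `SliceBound` for m = 1.
  conic-bound : ∀ n → n ℤ.* (1ℤ ℤ.+ n) ≡ (n ℤ.* 1ℤ) ℤ.* (n ℤ.* 1ℤ) ℤ.+ n ℤ.* 1ℤ
  conic-bound = solve 1 (λ n → n :* (con 1ℤ :+ n) := (n :* con 1ℤ) :* (n :* con 1ℤ) :+ n :* con 1ℤ) refl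

  centred-product : ∀ n i j → (n ℤ.* i ℤ.- 1ℤ) ℤ.* (n ℤ.* j ℤ.- 1ℤ) ≡ n ℤ.* n ℤ.* (i ℤ.* j) ℤ.+ (1ℤ ℤ.- n ℤ.* (i ℤ.+ j))
  centred-product = solve 3 (λ n i j → (n :* i :- con 1ℤ) :* (n :* j :- con 1ℤ) :=
      n :* n :* (i :* j) :+ (con 1ℤ :- n :* (i :+ j))) refl

  -- The constant 3 of the theorem arises here. One n p comes from the excess of the intersection
  -- over its mean, and one from the deficit of each of the two spheres.
  offDiagonal : ∀ n p → n ℤ.* (p ℤ.* p ℤ.+ p) ℤ.+ (n ℤ.* (p ℤ.* p) ℤ.- n ℤ.* ((p ℤ.* p ℤ.- p) ℤ.+ (p ℤ.* p ℤ.- p))) ≡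
    + 3 ℤ.* (n ℤ.* p)
  offDiagonal = solve 2 (λ n p → n :* (p :* p :+ p) :+ (n :* (p :* p) :- n :* ((p :* p :- p) :+ (p :* p :- p))) :=
      con (+ 3) :* (n :* p)) refl

  -- The right side is arranged so that the term 3 n p of the off-diagonal case reappears; what is
  -- subtracted is non-negative and will be discarded.
  onDiagonal : ∀ n p → n ℤ.* n ℤ.* (p ℤ.* p ℤ.- p) ℤ.+ (n ℤ.* (p ℤ.* p) ℤ.- n ℤ.* ((p ℤ.* p ℤ.- p) ℤ.+ (p ℤ.* p ℤ.- p))) ≡
               n ℤ.* n ℤ.* (p ℤ.* p) ℤ.+ + 3 ℤ.* (n ℤ.* p) ℤ.- (n ℤ.* (n ℤ.* p) ℤ.+ (n ℤ.* (p ℤ.* p) ℤ.+ n ℤ.* p))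
  onDiagonal = solve 2 (λ n p → n :* n :* (p :* p :- p) :+ (n :* (p :* p) :- n :* ((p :* p :- p) :+ (p :* p :- p))) :=
               n :* n :* (p :* p) :+ con (+ 3) :* (n :* p) :- (n :* (n :* p) :+ (n :* (p :* p) :+ n :* p))) refl

  variance-total : ∀ n p P S → P ℤ.* (S ℤ.* (n ℤ.* n ℤ.* (p ℤ.* p)) ℤ.+ S ℤ.* (S ℤ.* (+ 3 ℤ.* (n ℤ.* p)))) ≡
          n ℤ.* (n ℤ.* (p ℤ.* p ℤ.* P ℤ.* S)) ℤ.+ n ℤ.* (+ 3 ℤ.* p ℤ.* P ℤ.* (S ℤ.* S))
  variance-total = solve 4 (λ n p P S → P :* (S :* (n :* n :* (p :* p)) :+ S :* (S :* (con (+ 3) :* (n :* p)))) :=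
          n :* (n :* (p :* p :* P :* S)) :+ n :* (con (+ 3) :* p :* P :* (S :* S))) refl

open IntegerIdentities

-- Arithmetic and sums in a finite field.

module FieldProperties (F : FiniteField) where
  open FiniteField F

  commutativeRing : CommutativeRing _ _
  commutativeRing = record { isCommutativeRing = isCommutativeRing }

  open CommutativeRing commutativeRing public
    using (+-identityˡ; +-identityʳ; *-identityˡ; *-identityʳ; zeroˡ; zeroʳ; +-assoc; +-comm; *-comm; *-assoc; -‿inverseʳ; -‿inverseˡ)
  open IntegerCoefficients.Solver commutativeRing public
    using (solve; _:=_; _:+_; _:*_; _:-_; :-_; con)

  x*y≡0⇒y≡0 : ∀ {x y} → x ≢ 0F → x *F y ≡ 0F → y ≡ 0F
  x*y≡0⇒y≡0 {x} {y} x≢0 xy≡0 with x⁻¹ , xx⁻¹≡1 ← inverse x x≢0 = begin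
    y                  ≡⟨ sym (*-identityˡ y) ⟩
    1F *F y            ≡⟨ cong (_*F y) (sym xx⁻¹≡1) ⟩
    (x *F x⁻¹) *F y    ≡⟨ solve 3 (λ x i y → x :* i :* y := i :* (x :* y)) refl x x⁻¹ y ⟩
    x⁻¹ *F (x *F y)    ≡⟨ cong (x⁻¹ *F_) xy≡0 ⟩
    x⁻¹ *F 0F          ≡⟨ zeroʳ x⁻¹ ⟩
    0F                 ∎
    where open ≡-Reasoning

  x*y≢0 : ∀ {x y} → x ≢ 0F → y ≢ 0F → x *F y ≢ 0F
  x*y≢0 x≢0 y≢0 xy≡0 = y≢0 (x*y≡0⇒y≡0 x≢0 xy≡0)

  x-y≡0⇒x≡y : ∀ {x y} → x -F y ≡ 0F → x ≡ y
  x-y≡0⇒x≡y {x} {y} e = begin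
    x              ≡⟨ solve 2 (λ x y → x := x :- y :+ y) refl x y ⟩
    x -F y + y     ≡⟨ cong (_+ y) e ⟩
    0F + y         ≡⟨ +-identityˡ y ⟩
    y              ∎
    where open ≡-Reasoning

  x≡y⇒x-y≡0 : ∀ {x y} → x ≡ y → x -F y ≡ 0F
  x≡y⇒x-y≡0 {x} refl = -‿inverseʳ x

  ∑-affine : ∀ {u} → u ≢ 0F → ∀ v (f : Carrier → ℤ) → ∑[ x ∈ elems ] f (u *F x + v) ≡ ∑ elems f
  ∑-affine {u} u≢0 v f with u⁻¹ , uu⁻¹≡1 ← inverse u u≢0 =
    ∑-bijection _≟_ elems-unique elems-complete (λ x → u *F x + v) (λ y → u⁻¹ *F (y -F v))
      (λ x → trans (solve 4 (λ u i x v → i :* (u :* x :+ v :- v) := (u :* i) :* x) refl u u⁻¹ x v)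
                   (trans (cong (_*F x) uu⁻¹≡1) (*-identityˡ x)))
      (λ y → trans (cong (_+ v) (sym (*-assoc u u⁻¹ (y -F v))))
                   (trans (cong (λ e → e *F (y -F v) + v) uu⁻¹≡1)
                          (trans (cong (_+ v) (*-identityˡ (y -F v)))
                                 (solve 2 (λ y v → y :- v :+ v := y) refl y v))))
      f

  ∑-translate : ∀ v (f : Carrier → ℤ) → ∑[ x ∈ elems ] f (x + v) ≡ ∑ elems f
  ∑-translate v f = trans (∑-cong elems (λ x → cong (λ y → f (y + v)) (sym (*-identityˡ x)))) (∑-affine (0≢1 ∘ sym) v f)

  ∑-𝟙-≟ : ∀ k → ∑[ x ∈ elems ] 𝟙 (x ≟ k) ≡ 1ℤ
  ∑-𝟙-≟ k = trans (∑-cong elems (λ x → trans (𝟙-cong sym sym (x ≟ k) (k ≟ x)) (sym (ℤₚ.*-identityʳ _))))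
                  (∑-𝟙 _≟_ elems-unique (elems-complete k) (λ _ → 1ℤ))

  η≡-1⇒≢0 : ∀ {x} → η x ≡ -[1+ 0 ] → x ≢ 0F
  η≡-1⇒≢0 {x} e with x ≟ 0F
  ... | no x≢0 = x≢0
  ... | yes _ with () ← e

  η≡-1⇒nonSquare : ∀ {x} → η x ≡ -[1+ 0 ] → ∀ y → y *F y ≢ x
  η≡-1⇒nonSquare {x} e y yy≡x with x ≟ 0F
  ... | yes _ with () ← e
  ... | no _ with isSquare? x
  ...   | yes _ with () ← e
  ...   | no ¬sq = ¬sq (lose (elems-complete y) yy≡x)

  η≡1⇒square : ∀ {x} → η x ≡ + 1 → ∃ λ y → y *F y ≡ x
  η≡1⇒square {x} e with x ≟ 0F
  ... | yes _ with () ← e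
  ... | no _ with isSquare? x
  ...   | yes sq = satisfied sq
  ...   | no _ with () ← e

  -- In characteristic two squaring is injective, hence surjective on a finite field.
  nonSquare⇒2≢0 : ∀ {ε} → (∀ y → y *F y ≢ ε) → 1F + 1F ≢ 0F
  nonSquare⇒2≢0 {ε} ε≢□ 2≡0 = ℕₚ.<-irrefl refl (subst (ℕ._≤ size) (cong suc (Listₚ.length-map _ elems))
    (length-⊆ _≟_ elems-unique elems-complete
      (Allₚ.map⁺ (All.universal (λ y e → ε≢□ y (sym e)) elems) ∷ Uniqueₚ.map⁺ square-injective elems-unique)))
    where
    square-injective : ∀ {x y} → x *F x ≡ y *F y → x ≡ y
    square-injective {x} {y} e with (x -F y) ≟ 0F
    ... | yes x-y≡0 = x-y≡0⇒x≡y x-y≡0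
    ... | no x-y≢0  = contradiction (begin
      (x -F y) *F (x -F y)
        ≡⟨ solve 2 (λ x y → (x :- y) :* (x :- y) := x :* x :+ y :* y :- (x :* y :+ x :* y)) refl x y ⟩
      (x *F x + y *F y) -F (x *F y + x *F y)               ≡⟨ cong (λ z → (z + y *F y) -F (x *F y + x *F y)) e ⟩
      (y *F y + y *F y) -F (x *F y + x *F y)               ≡⟨ cong₂ _-F_ (double (y *F y)) (double (x *F y)) ⟩
      0F -F 0F                                             ≡⟨ -‿inverseʳ 0F ⟩
      0F                                                   ∎)
      (x*y≢0 x-y≢0 x-y≢0)
      where
      open ≡-Reasoning
      double : ∀ z → z + z ≡ 0F
      double z = trans (cong₂ _+_ (sym (*-identityˡ z)) (sym (*-identityˡ z)))
        (trans (solve 2 (λ i z → i :* z :+ i :* z := (i :+ i) :* z) refl 1F z) (trans (cong (_*F z) 2≡0) (zeroˡ z)))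

-- Points as m planes and a line; linear forms on them.

module Points (F : FiniteField) where
  open FiniteField F
  open FieldProperties F

  -- The coordinates are grouped as the quadratic form pairs them, with the single remaining
  -- coordinate innermost, so that induction on m removes a hyperbolic plane from the front.
  data Pt : ℕ → Set where
    [_]     : Carrier → Pt zero
    ⟨_,_,_⟩ : ∀ {m} → Carrier → Carrier → Pt m → Pt (suc m)

  attach : ∀ {m} → Carrier × Carrier × Pt m → Pt (suc m)
  attach (a , b , x) = ⟨ a , b , x ⟩

  pts : ∀ m → List (Pt m)
  pts zero    = map [_] elems
  pts (suc m) = map attach (cartesianProduct elems (cartesianProduct elems (pts m)))

  pts-unique : ∀ m → Unique (pts m)
  pts-unique zero    = Uniqueₚ.map⁺ (λ { refl → refl }) elems-unique
  pts-unique (suc m) = Uniqueₚ.map⁺ (λ { refl → refl })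
    (Uniqueₚ.cartesianProduct⁺ elems-unique (Uniqueₚ.cartesianProduct⁺ elems-unique (pts-unique m)))

  pts-complete : ∀ {m} (x : Pt m) → x ∈ pts m
  pts-complete [ t ]         = ∈-map⁺ [_] (elems-complete t)
  pts-complete ⟨ a , b , x ⟩ = ∈-map⁺ attach
    (∈-cartesianProduct⁺ (elems-complete a) (∈-cartesianProduct⁺ (elems-complete b) (pts-complete x)))

  _≟ₚ_ : ∀ {m} → DecidableEquality (Pt m)
  [ t ]         ≟ₚ [ t′ ]          = map′ (cong [_]) (λ { refl → refl }) (t ≟ t′)
  ⟨ a , b , x ⟩ ≟ₚ ⟨ a′ , b′ , y ⟩ =
    map′ (λ { (refl , refl , refl) → refl }) (λ { refl → refl , refl , refl }) (a ≟ a′ ×-dec b ≟ b′ ×-dec x ≟ₚ y)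

  infixl 6 _⊕_ _⊖_

  _⊕_ _⊖_ : ∀ {m} → Pt m → Pt m → Pt m
  [ t ]         ⊕ [ t′ ]          = [ t + t′ ]
  ⟨ a , b , x ⟩ ⊕ ⟨ a′ , b′ , y ⟩ = ⟨ a + a′ , b + b′ , x ⊕ y ⟩
  [ t ]         ⊖ [ t′ ]          = [ t -F t′ ]
  ⟨ a , b , x ⟩ ⊖ ⟨ a′ , b′ , y ⟩ = ⟨ a -F a′ , b -F b′ , x ⊖ y ⟩

  origin : ∀ m → Pt m
  origin zero    = [ 0F ]
  origin (suc m) = ⟨ 0F , 0F , origin m ⟩

  ⟨⟩-cong : ∀ {m} {a a′ b b′ : Carrier} {x x′ : Pt m} → a ≡ a′ → b ≡ b′ → x ≡ x′ → ⟨ a , b , x ⟩ ≡ ⟨ a′ , b′ , x′ ⟩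
  ⟨⟩-cong refl refl refl = refl

  []-injective : ∀ {s t} → _≡_ {A = Pt zero} [ s ] [ t ] → s ≡ t
  []-injective refl = refl

  ⟨⟩-injective : ∀ {m a a′ b b′} {x x′ : Pt m} → ⟨ a , b , x ⟩ ≡ ⟨ a′ , b′ , x′ ⟩ → a ≡ a′ × b ≡ b′ × x ≡ x′
  ⟨⟩-injective refl = refl , refl , refl

  private
    x-y+y≡x : ∀ x y → x -F y + y ≡ x
    x-y+y≡x = solve 2 (λ x y → x :- y :+ y := x) refl

    x+y-y≡x : ∀ x y → (x + y) -F y ≡ x
    x+y-y≡x = solve 2 (λ x y → x :+ y :- y := x) refl

    [x-y]-[z-y]≡x-z : ∀ x y z → (x -F y) -F (z -F y) ≡ x -F z
    [x-y]-[z-y]≡x-z = solve 3 (λ x y z → (x :- y) :- (z :- y) := x :- z) refl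

  ⊖-⊕ : ∀ {m} (x y : Pt m) → (x ⊖ y) ⊕ y ≡ x
  ⊖-⊕ [ t ]         [ t′ ]          = cong [_] (x-y+y≡x t t′)
  ⊖-⊕ ⟨ a , b , x ⟩ ⟨ a′ , b′ , y ⟩ = ⟨⟩-cong (x-y+y≡x a a′) (x-y+y≡x b b′) (⊖-⊕ x y)

  ⊕-⊖ : ∀ {m} (x y : Pt m) → (x ⊕ y) ⊖ y ≡ x
  ⊕-⊖ [ t ]         [ t′ ]          = cong [_] (x+y-y≡x t t′)
  ⊕-⊖ ⟨ a , b , x ⟩ ⟨ a′ , b′ , y ⟩ = ⟨⟩-cong (x+y-y≡x a a′) (x+y-y≡x b b′) (⊕-⊖ x y)

  ⊖-⊖-⊖ : ∀ {m} (x y z : Pt m) → (x ⊖ y) ⊖ (z ⊖ y) ≡ x ⊖ z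
  ⊖-⊖-⊖ [ t ] [ t′ ] [ t″ ] = cong [_] ([x-y]-[z-y]≡x-z t t′ t″)
  ⊖-⊖-⊖ ⟨ a , b , x ⟩ ⟨ a′ , b′ , y ⟩ ⟨ a″ , b″ , z ⟩ =
    ⟨⟩-cong ([x-y]-[z-y]≡x-z a a′ a″) ([x-y]-[z-y]≡x-z b b′ b″) (⊖-⊖-⊖ x y z)

  ⊖≡origin⇒≡ : ∀ {m} (x y : Pt m) → x ⊖ y ≡ origin m → x ≡ y
  ⊖≡origin⇒≡ [ t ] [ t′ ] e = cong [_] (x-y≡0⇒x≡y ([]-injective e))
  ⊖≡origin⇒≡ ⟨ a , b , x ⟩ ⟨ a′ , b′ , y ⟩ e with e₁ , e₂ , e₃ ← ⟨⟩-injective e =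
    ⟨⟩-cong (x-y≡0⇒x≡y e₁) (x-y≡0⇒x≡y e₂) (⊖≡origin⇒≡ x y e₃)

  ∑-pts-zero : (f : Pt zero → ℤ) → ∑ (pts zero) f ≡ ∑[ t ∈ elems ] f [ t ]
  ∑-pts-zero = ∑-map [_] elems

  ∑-pts-suc : ∀ m (f : Pt (suc m) → ℤ) →
              ∑ (pts (suc m)) f ≡ ∑[ a ∈ elems ] ∑[ b ∈ elems ] ∑[ x ∈ pts m ] f ⟨ a , b , x ⟩
  ∑-pts-suc m f = trans (∑-map attach (cartesianProduct elems (cartesianProduct elems (pts m))) f)
    (trans (∑-cartesianProduct elems (cartesianProduct elems (pts m)) (f ∘ attach))
    (∑-cong elems (λ a → ∑-cartesianProduct elems (pts m) (λ (b , x) → f ⟨ a , b , x ⟩))))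

  ∑-pts-bijection : ∀ {m} (π π⁻¹ : Pt m → Pt m) → (∀ x → π⁻¹ (π x) ≡ x) → (∀ x → π (π⁻¹ x) ≡ x) →
                    ∀ f → ∑[ x ∈ pts m ] f (π x) ≡ ∑ (pts m) f
  ∑-pts-bijection {m} = ∑-bijection _≟ₚ_ (pts-unique m) pts-complete

  n : ℤ
  n = + size

  length-pts : ∀ m → ∑[ x ∈ pts m ] 1ℤ ≡ n ℤ.* (n ℤ.^ m ℤ.* n ℤ.^ m)
  length-pts zero    = trans (∑-pts-zero (λ _ → 1ℤ)) (∑-const elems 1ℤ)
  length-pts (suc m) = trans (∑-pts-suc m (λ _ → 1ℤ)) (trans
    (∑-cong elems (λ _ → trans (∑-cong elems (λ _ → length-pts m)) (∑-const elems _)))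
    (trans (∑-const elems _) (trans (cong (λ k → n ℤ.* (n ℤ.* k)) (ℤₚ.*-comm n _)) (trans (square-scale n (n ℤ.^ m) n) (ℤₚ.*-comm _ n)))))

  lin : ∀ {m} → Pt m → Pt m → Carrier
  lin [ γ ]         [ t ]         = γ *F t
  lin ⟨ α , β , ρ ⟩ ⟨ a , b , x ⟩ = α *F a + (β *F b + lin ρ x)

  NonZero : ∀ {m} → Pt m → Set
  NonZero [ γ ]         = γ ≢ 0F
  NonZero ⟨ α , β , ρ ⟩ = α ≢ 0F ⊎ β ≢ 0F ⊎ NonZero ρ

  nonZero? : ∀ {m} (ρ : Pt m) → NonZero ρ ⊎ ρ ≡ origin m
  nonZero? [ γ ] with γ ≟ 0F
  ... | yes γ≡0 = inj₂ (cong [_] γ≡0)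
  ... | no γ≢0  = inj₁ γ≢0
  nonZero? ⟨ α , β , ρ ⟩ with α ≟ 0F | β ≟ 0F | nonZero? ρ
  ... | no α≢0  | _       | _        = inj₁ (inj₁ α≢0)
  ... | yes _   | no β≢0  | _        = inj₁ (inj₂ (inj₁ β≢0))
  ... | yes _   | yes _   | inj₁ ρ≢0 = inj₁ (inj₂ (inj₂ ρ≢0))
  ... | yes α≡0 | yes β≡0 | inj₂ ρ≡0 = inj₂ (⟨⟩-cong α≡0 β≡0 ρ≡0)

  lin-origin : ∀ {m} (x : Pt m) → lin (origin m) x ≡ 0F
  lin-origin [ t ]         = zeroˡ t
  lin-origin ⟨ a , b , x ⟩ = trans
    (cong₂ _+_ (zeroˡ a) (trans (cong₂ _+_ (zeroˡ b) (lin-origin x)) (+-identityˡ 0F))) (+-identityˡ 0F)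

  -- A non-zero form is equidistributed: summing first over a coordinate with non-zero coefficient
  -- is an affine substitution, whatever the values of the others.
  ∑-lin : ∀ {m} (ρ : Pt m) → NonZero ρ → ∀ (h : Carrier → ℤ) →
          ∑[ x ∈ pts m ] h (lin ρ x) ≡ (n ℤ.^ m ℤ.* n ℤ.^ m) ℤ.* ∑ elems h
  ∑-lin {zero} [ γ ] γ≢0 h = trans (∑-pts-zero (λ x → h (lin [ γ ] x))) (trans (∑-cong elems (λ t → cong h (sym (+-identityʳ _))))
    (trans (∑-affine γ≢0 0F h) (sym (ℤₚ.*-identityˡ _))))
  ∑-lin {suc m} ⟨ α , β , ρ ⟩ (inj₁ α≢0) h = begin
    ∑ (pts (suc m)) (λ x → h (lin ⟨ α , β , ρ ⟩ x))
      ≡⟨ ∑-pts-suc m _ ⟩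
    ∑[ a ∈ elems ] ∑[ b ∈ elems ] ∑[ x ∈ pts m ] h (α *F a + (β *F b + lin ρ x))
      ≡⟨ ∑-swap elems elems _ ⟩
    ∑[ b ∈ elems ] ∑[ a ∈ elems ] ∑[ x ∈ pts m ] h (α *F a + (β *F b + lin ρ x))
      ≡⟨ ∑-cong elems (λ b → trans (∑-swap elems (pts m) _) (∑-cong (pts m) (λ x → trans (∑-affine α≢0 _ h) (sym (ℤₚ.*-identityˡ _))))) ⟩
    ∑[ b ∈ elems ] ∑[ x ∈ pts m ] 1ℤ ℤ.* ∑ elems h
      ≡⟨ ∑-cong elems (λ b → trans (∑-*ʳ (pts m) (λ _ → 1ℤ) _) (cong (ℤ._* ∑ elems h) (length-pts m))) ⟩
    ∑[ b ∈ elems ] n ℤ.* (n ℤ.^ m ℤ.* n ℤ.^ m) ℤ.* ∑ elems h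
      ≡⟨ ∑-const elems _ ⟩
    n ℤ.* (n ℤ.* (n ℤ.^ m ℤ.* n ℤ.^ m) ℤ.* ∑ elems h)
      ≡⟨ cong (n ℤ.*_) (ℤₚ.*-assoc n _ _) ⟩
    n ℤ.* (n ℤ.* ((n ℤ.^ m ℤ.* n ℤ.^ m) ℤ.* ∑ elems h))
      ≡⟨ square-scale n (n ℤ.^ m) (∑ elems h) ⟩
    n ℤ.^ suc m ℤ.* n ℤ.^ suc m ℤ.* ∑ elems h ∎
    where open ≡-Reasoning
  ∑-lin {suc m} ⟨ α , β , ρ ⟩ (inj₂ (inj₁ β≢0)) h = begin
    ∑ (pts (suc m)) (λ x → h (lin ⟨ α , β , ρ ⟩ x))
      ≡⟨ ∑-pts-suc m _ ⟩
    ∑[ a ∈ elems ] ∑[ b ∈ elems ] ∑[ x ∈ pts m ] h (α *F a + (β *F b + lin ρ x))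
      ≡⟨ ∑-swap elems elems _ ⟩
    ∑[ b ∈ elems ] ∑[ a ∈ elems ] ∑[ x ∈ pts m ] h (α *F a + (β *F b + lin ρ x))
      ≡⟨ ∑-cong elems (λ b → ∑-cong elems (λ a → ∑-cong (pts m) (λ x → cong h
           (solve 3 (λ u v w → u :+ (v :+ w) := v :+ (u :+ w)) refl (α *F a) (β *F b) (lin ρ x))))) ⟩
    ∑[ b ∈ elems ] ∑[ a ∈ elems ] ∑[ x ∈ pts m ] h (β *F b + (α *F a + lin ρ x))
      ≡⟨ sym (∑-pts-suc m _) ⟩
    ∑ (pts (suc m)) (λ x → h (lin ⟨ β , α , ρ ⟩ x))
      ≡⟨ ∑-lin ⟨ β , α , ρ ⟩ (inj₁ β≢0) h ⟩
    n ℤ.^ suc m ℤ.* n ℤ.^ suc m ℤ.* ∑ elems h ∎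
    where open ≡-Reasoning
  ∑-lin {suc m} ⟨ α , β , ρ ⟩ (inj₂ (inj₂ ρ≢0)) h = begin
    ∑ (pts (suc m)) (λ x → h (lin ⟨ α , β , ρ ⟩ x))
      ≡⟨ ∑-pts-suc m _ ⟩
    ∑[ a ∈ elems ] ∑[ b ∈ elems ] ∑[ x ∈ pts m ] h (α *F a + (β *F b + lin ρ x))
      ≡⟨ ∑-cong elems (λ a → ∑-cong elems (λ b → ∑-lin-translate a b)) ⟩
    ∑[ a ∈ elems ] ∑[ b ∈ elems ] (n ℤ.^ m ℤ.* n ℤ.^ m) ℤ.* ∑ elems h
      ≡⟨ trans (∑-cong elems (λ _ → ∑-const elems _)) (∑-const elems _) ⟩
    n ℤ.* (n ℤ.* ((n ℤ.^ m ℤ.* n ℤ.^ m) ℤ.* ∑ elems h))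
      ≡⟨ square-scale n (n ℤ.^ m) (∑ elems h) ⟩
    n ℤ.^ suc m ℤ.* n ℤ.^ suc m ℤ.* ∑ elems h ∎
    where
    open ≡-Reasoning
    ∑-lin-translate : ∀ a b → ∑[ x ∈ pts m ] h (α *F a + (β *F b + lin ρ x)) ≡ (n ℤ.^ m ℤ.* n ℤ.^ m) ℤ.* ∑ elems h
    ∑-lin-translate a b = trans
      (∑-cong (pts m) (λ x → cong h (solve 3 (λ u v w → u :+ (v :+ w) :=
          w :+ (u :+ v)) refl (α *F a) (β *F b) (lin ρ x))))
      (trans (∑-lin ρ ρ≢0 (λ k → h (k + (α *F a + β *F b)))) (cong (n ℤ.^ m ℤ.* n ℤ.^ m ℤ.*_) (∑-translate (α *F a + β *F b) h)))

-- The quadratic form, its joint distribution with a linear form, and sphere sizes.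

module Quadric (F : FiniteField) (c : FiniteField.Carrier F) (c≢0 : c ≢ FiniteField.0F F) where
  open FiniteField F
  open FieldProperties F
  open Points F

  q : ∀ {m} → Pt m → Carrier
  q [ t ]         = -F (c *F (t *F t))
  q ⟨ a , b , x ⟩ = a *F b + q x

  -- Equivalently, the binary form c t² + r u² has no non-trivial zero; t = 0 gives r ≠ 0. Thus m is
  -- the Witt index of the homogenised sphere equation, which defines an elliptic quadric.
  Elliptic : Carrier → Set
  Elliptic r = ∀ t → r + c *F (t *F t) ≢ 0F

  -- An arbitrary test function `f` lets one recursion serve both spheres (`f` ignores the linear
  -- form) and their hyperplane sections.
  joint : ∀ {m} → Pt m → (Carrier → Carrier → ℤ) → ℤ
  joint {m} ρ f = ∑[ x ∈ pts m ] f (q x) (lin ρ x)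

  joint-isometry : ∀ {m} {ρ ρ′ : Pt m} (π π⁻¹ : Pt m → Pt m) → (∀ x → π⁻¹ (π x) ≡ x) → (∀ x → π (π⁻¹ x) ≡ x) →
               (∀ x → q (π x) ≡ q x) → (∀ x → lin ρ (π x) ≡ lin ρ′ x) → ∀ f → joint ρ f ≡ joint ρ′ f
  joint-isometry {m} {ρ} {ρ′} π π⁻¹ invˡ invʳ q-inv lin-inv f = trans
    (sym (∑-pts-bijection π π⁻¹ invˡ invʳ (λ x → f (q x) (lin ρ x))))
    (∑-cong (pts m) (λ x → cong₂ f (q-inv x) (lin-inv x)))

  -- For b ≠ 0 the map from a to a b permutes the field, so the product may be replaced by a free
  -- variable. The column b = 0 is the exception: its free sum is removed and n copies of the value
  -- at 0 are put back.
  ∑-hyperbolicPlane : ∀ (g : Carrier → Carrier → ℤ) →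
    ∑[ a ∈ elems ] ∑[ b ∈ elems ] g (a *F b) b ≡
    (∑[ b ∈ elems ] ∑[ a ∈ elems ] g a b) ℤ.- (∑[ a ∈ elems ] g a 0F) ℤ.+ n ℤ.* g 0F 0F
  ∑-hyperbolicPlane g = begin
    ∑[ a ∈ elems ] ∑[ b ∈ elems ] g (a *F b) b
      ≡⟨ ∑-swap elems elems _ ⟩
    ∑[ b ∈ elems ] ∑[ a ∈ elems ] g (a *F b) b
      ≡⟨ ∑-cong elems column ⟩
    ∑[ b ∈ elems ] (G b ℤ.+ 𝟙 (0F ≟ b) ℤ.* (n ℤ.* g 0F b ℤ.- G b))
      ≡⟨ ∑-+ elems G _ ⟩
    ∑ elems G ℤ.+ (∑[ b ∈ elems ] 𝟙 (0F ≟ b) ℤ.* (n ℤ.* g 0F b ℤ.- G b))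
      ≡⟨ cong (ℤ._+_ (∑ elems G)) (∑-𝟙 _≟_ elems-unique (elems-complete 0F) (λ b → n ℤ.* g 0F b ℤ.- G b)) ⟩
    ∑ elems G ℤ.+ (n ℤ.* g 0F 0F ℤ.- G 0F)
      ≡⟨ cong (ℤ._+_ (∑ elems G)) (ℤₚ.+-comm (n ℤ.* g 0F 0F) (ℤ.- G 0F)) ⟩
    ∑ elems G ℤ.+ (ℤ.- G 0F ℤ.+ n ℤ.* g 0F 0F)
      ≡⟨ sym (ℤₚ.+-assoc (∑ elems G) (ℤ.- G 0F) (n ℤ.* g 0F 0F)) ⟩
    ∑ elems G ℤ.- G 0F ℤ.+ n ℤ.* g 0F 0F ∎
    where
    open ≡-Reasoning
    G : Carrier → ℤ
    G b = ∑[ a ∈ elems ] g a b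
    cancel : ∀ i j → i ≡ j ℤ.+ 1ℤ ℤ.* (i ℤ.- j)
    cancel = +-*-Solver.solve 2 (λ i j → i +-*-Solver.:= j +-*-Solver.:+ +-*-Solver.con 1ℤ +-*-Solver.:* (i +-*-Solver.:- j)) refl
    column : ∀ b → ∑[ a ∈ elems ] g (a *F b) b ≡ G b ℤ.+ 𝟙 (0F ≟ b) ℤ.* (n ℤ.* g 0F b ℤ.- G b)
    column b with 0F ≟ b
    ... | yes refl = trans (∑-cong elems (λ a → cong (λ k → g k 0F) (zeroʳ a)))
                       (trans (∑-const elems (g 0F 0F)) (cancel (n ℤ.* g 0F 0F) (G 0F)))
    ... | no 0≢b   = trans
      (∑-cong elems (λ a → cong (λ k → g k b) (trans (*-comm a b) (sym (+-identityʳ _)))))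
      (trans (∑-affine (0≢b ∘ sym) 0F (λ a → g a b)) (sym (ℤₚ.+-identityʳ (G b))))

  -- With coefficient 0 at a, only the quadratic form sees a. Where b ≠ 0 this makes its value
  -- uniform and leaves the sums `h`; the last two terms correct the column b = 0, on which the
  -- smaller form takes over.
  joint-plane : ∀ {m} β (ρ : Pt m) (f : Carrier → Carrier → ℤ) → let h = λ k → ∑[ a ∈ elems ] f a k in
    joint ⟨ 0F , β , ρ ⟩ f ≡
    (∑[ b ∈ elems ] ∑[ x ∈ pts m ] h (β *F b + lin ρ x)) ℤ.- (∑[ x ∈ pts m ] h (lin ρ x)) ℤ.+ n ℤ.* joint ρ f
  joint-plane {m} β ρ f = begin
    joint ⟨ 0F , β , ρ ⟩ f
      ≡⟨ ∑-pts-suc m (λ x → f (q x) (lin ⟨ 0F , β , ρ ⟩ x)) ⟩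
    ∑[ a ∈ elems ] ∑[ b ∈ elems ] ∑[ x ∈ pts m ] f (a *F b + q x) (0F *F a + (β *F b + lin ρ x))
      ≡⟨ ∑-cong elems (λ a → ∑-cong elems (λ b → ∑-cong (pts m) (λ x → cong (f (a *F b + q x)) (trans (cong (_+ (β *F b + lin ρ x)) (zeroˡ a)) (+-identityˡ _))))) ⟩
    ∑[ a ∈ elems ] ∑[ b ∈ elems ] g (a *F b) b
      ≡⟨ ∑-hyperbolicPlane g ⟩
    (∑[ b ∈ elems ] ∑[ a ∈ elems ] g a b) ℤ.- (∑[ a ∈ elems ] g a 0F) ℤ.+ n ℤ.* g 0F 0F
      ≡⟨ cong₂ ℤ._+_ (cong₂ ℤ._-_ (∑-cong elems shift) shift₀) (cong (n ℤ.*_) at-0) ⟩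
    (∑[ b ∈ elems ] ∑[ x ∈ pts m ] h (β *F b + lin ρ x)) ℤ.- (∑[ x ∈ pts m ] h (lin ρ x)) ℤ.+ n ℤ.* joint ρ f ∎
    where
    open ≡-Reasoning
    h : Carrier → ℤ
    h k = ∑[ a ∈ elems ] f a k
    g : Carrier → Carrier → ℤ
    g a b = ∑[ x ∈ pts m ] f (a + q x) (β *F b + lin ρ x)
    shift : ∀ b → ∑[ a ∈ elems ] g a b ≡ ∑[ x ∈ pts m ] h (β *F b + lin ρ x)
    shift b = trans (∑-swap elems (pts m) _)
      (∑-cong (pts m) (λ x → ∑-translate (q x) (λ a → f a (β *F b + lin ρ x))))
    β0+k≡k : ∀ k → β *F 0F + k ≡ k
    β0+k≡k k = trans (cong (_+ k) (zeroʳ β)) (+-identityˡ k)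
    shift₀ : ∑[ a ∈ elems ] g a 0F ≡ ∑[ x ∈ pts m ] h (lin ρ x)
    shift₀ = trans (shift 0F) (∑-cong (pts m) (λ x → cong h (β0+k≡k (lin ρ x))))
    at-0 : g 0F 0F ≡ joint ρ f
    at-0 = ∑-cong (pts m) (λ x → cong₂ f (+-identityˡ (q x)) (β0+k≡k (lin ρ x)))

  elliptic⇒-ct²≢r : ∀ {r} → Elliptic r → ∀ t → -F (c *F (t *F t)) ≢ r
  elliptic⇒-ct²≢r ell t refl = ell t (-‿inverseˡ (c *F (t *F t)))

  sphere-count : ∀ m {r} → Elliptic r → ∑[ x ∈ pts m ] 𝟙 (q x ≟ r) ≡ n ℤ.^ m ℤ.* n ℤ.^ m ℤ.- n ℤ.^ m
  sphere-count zero    {r} ell = trans (∑-pts-zero (λ x → 𝟙 (q x ≟ r)))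
    (trans (∑-cong elems (λ t → 𝟙-no (q [ t ] ≟ r) (elliptic⇒-ct²≢r ell t))) (∑-zero elems))
  sphere-count (suc m) {r} ell = begin
    ∑[ x ∈ pts (suc m) ] 𝟙 (q x ≟ r)
      -- The second argument of the test function is ignored, so any linear form would do; the zero
      -- form has the required leading coefficient.
      ≡⟨ joint-plane 0F (origin m) (λ u _ → 𝟙 (u ≟ r)) ⟩
    (∑[ b ∈ elems ] ∑[ x ∈ pts m ] ∑[ a ∈ elems ] 𝟙 (a ≟ r)) ℤ.- (∑[ x ∈ pts m ] ∑[ a ∈ elems ] 𝟙 (a ≟ r)) ℤ.+ n ℤ.* (∑[ x ∈ pts m ] 𝟙 (q x ≟ r))
      ≡⟨ cong₂ (λ i j → i ℤ.+ n ℤ.* j)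
           (cong₂ ℤ._-_ (trans (∑-cong elems (λ _ → ones)) (∑-const elems _)) ones) (sphere-count m ell) ⟩
    n ℤ.* (n ℤ.* (p ℤ.* p)) ℤ.- n ℤ.* (p ℤ.* p) ℤ.+ n ℤ.* (p ℤ.* p ℤ.- p)
      ≡⟨ sphere-count-suc n p ⟩
    n ℤ.^ suc m ℤ.* n ℤ.^ suc m ℤ.- n ℤ.^ suc m ∎
    where
    open ≡-Reasoning
    p = n ℤ.^ m
    ones : ∑[ x ∈ pts m ] ∑[ a ∈ elems ] 𝟙 (a ≟ r) ≡ n ℤ.* (p ℤ.* p)
    ones = trans (∑-cong (pts m) (λ _ → ∑-𝟙-≟ r)) (length-pts m)

  -- Plane sections of a three-dimensional quadric.

  module Conic {α β γ k r : Carrier} (α≢0 : α ≢ 0F) (β≢0 : β ≢ 0F) (ell : Elliptic r) where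

    OnConic : Pt 1 → Set
    OnConic x = q x ≡ r × lin ⟨ α , β , [ γ ] ⟩ x ≡ k

    onConic? : ∀ x → Dec (OnConic x)
    onConic? x = (q x ≟ r) ×-dec (lin ⟨ α , β , [ γ ] ⟩ x ≟ k)

    module Slope (a₀ b₀ t₀ : Carrier) (on₀ : OnConic ⟨ a₀ , b₀ , [ t₀ ] ⟩) where

      -- Eliminating a by the plane equation turns α q into a polynomial in b and t. Its partial
      -- derivatives at the base point are A and -B, so A x = B y is the tangent.
      A B : Carrier
      A = (α *F a₀) -F (β *F b₀)
      B = γ *F b₀ + (α *F c *F t₀ + α *F c *F t₀)

      -- Up to the factor -α this is the value of `q` on the direction in the plane whose b and t
      -- components are s and 1; a zero is an isotropic direction.
      disc : Carrier → Carrier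
      disc s = β *F s *F s + γ *F s + α *F c

      -- The line through the base point would lie on the conic, in an isotropic direction v; but v⊥/v is
      -- spanned by a vector of norm -c modulo squares, so r would be -c times a square.
      no-line : ∀ s → disc s ≡ 0F → A *F s ≢ B
      no-line s disc≡0 As≡B with s ≟ 0F
      ... | yes refl = x*y≢0 α≢0 c≢0 (trans (sym (solve 4 (λ α β γ c → β :* con 0ℤ :* con 0ℤ :+ γ :* con 0ℤ :+ α :* c := α :* c) refl α β γ c)) disc≡0)
      ... | no s≢0 with u , su≡1 ← inverse s s≢0 =
        ell w (x*y≡0⇒y≡0 s≢0 (x*y≡0⇒y≡0 s≢0 (x*y≡0⇒y≡0 α≢0 scaled)))
        where
        open ≡-Reasoning
        -- The line meets b = 0 at t = -w. There the form is -c w², and it would have to equal r.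
        w = (b₀ *F u) -F t₀
        sw : s *F w ≡ b₀ -F (s *F t₀)
        sw = begin
          s *F ((b₀ *F u) -F t₀)
            ≡⟨ solve 4 (λ s b u t → s :* (b :* u :- t) := b :* (s :* u) :- s :* t) refl s b₀ u t₀ ⟩
          (b₀ *F (s *F u)) -F (s *F t₀)   ≡⟨ cong (λ e → (b₀ *F e) -F (s *F t₀)) su≡1 ⟩
          (b₀ *F 1F) -F (s *F t₀)         ≡⟨ cong (_-F (s *F t₀)) (trans (*-comm b₀ 1F) (*-identityˡ b₀)) ⟩
          b₀ -F (s *F t₀)                 ∎
        z = b₀ -F (s *F t₀)
        scaled : α *F (s *F (s *F (r + c *F (w *F w)))) ≡ 0F
        scaled = begin
          α *F (s *F (s *F (r + c *F (w *F w))))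
            ≡⟨ cong (λ e → α *F (s *F (s *F (e + c *F (w *F w))))) (sym (proj₁ on₀)) ⟩
          α *F (s *F (s *F (a₀ *F b₀ + (-F (c *F (t₀ *F t₀))) + c *F (w *F w))))
            ≡⟨ solve 7 (λ α s a b c t w → α :* (s :* (s :* (a :* b :+ :- (c :* (t :* t)) :+ c :* (w :* w))))
                 := α :* s :* s :* (a :* b :- c :* t :* t) :+ α :* c :* ((s :* w) :* (s :* w))) refl α s a₀ b₀ c t₀ w ⟩
          α *F s *F s *F ((a₀ *F b₀) -F (c *F t₀ *F t₀)) + α *F c *F ((s *F w) *F (s *F w))
            ≡⟨ cong (λ e → α *F s *F s *F ((a₀ *F b₀) -F (c *F t₀ *F t₀)) + α *F c *F (e *F e)) sw ⟩
          α *F s *F s *F ((a₀ *F b₀) -F (c *F t₀ *F t₀)) + α *F c *F (z *F z)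
            ≡⟨ solve 8 (λ α β γ s a b c t → α :* s :* s :* (a :* b :- c :* t :* t) :+ α :* c :* ((b :- s :* t) :* (b :- s :* t))
                 := b :* b :* (β :* s :* s :+ γ :* s :+ α :* c)
                    :+ s :* b :* ((α :* a :- β :* b) :* s :- (γ :* b :+ (α :* c :* t :+ α :* c :* t)))) refl α β γ s a₀ b₀ c t₀ ⟩
          b₀ *F b₀ *F disc s + s *F b₀ *F ((A *F s) -F B)
            ≡⟨ cong₂ (λ d e → b₀ *F b₀ *F d + s *F b₀ *F e) disc≡0 (x≡y⇒x-y≡0 As≡B) ⟩
          b₀ *F b₀ *F 0F + s *F b₀ *F 0F
            ≡⟨ trans (cong₂ _+_ (zeroʳ _) (zeroʳ _)) (+-identityˡ 0F) ⟩
          0F ∎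

      -- Taking α times the difference of the quadric equations minus b times the difference of the
      -- plane equations eliminates a.
      chord : ∀ a b t → OnConic ⟨ a , b , [ t ] ⟩ → let x = b -F b₀; y = t -F t₀ in
              (A *F x) -F (B *F y) ≡ β *F x *F x + γ *F x *F y + α *F c *F y *F y
      chord a b t on = x-y≡0⇒x≡y (begin
        ((A *F x) -F (B *F y)) -F (β *F x *F x + γ *F x *F y + α *F c *F y *F y)
          ≡⟨ solve 10 (λ α β γ c a b t a₀ b₀ t₀ →
               ((α :* a₀ :- β :* b₀) :* (b :- b₀) :- (γ :* b₀ :+ (α :* c :* t₀ :+ α :* c :* t₀)) :* (t :- t₀))
                 :- (β :* (b :- b₀) :* (b :- b₀) :+ γ :* (b :- b₀) :* (t :- t₀) :+ α :* c :* (t :- t₀) :* (t :- t₀))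
               := α :* ((a :* b :+ :- (c :* (t :* t))) :- (a₀ :* b₀ :+ :- (c :* (t₀ :* t₀))))
                 :- b :* ((α :* a :+ (β :* b :+ γ :* t)) :- (α :* a₀ :+ (β :* b₀ :+ γ :* t₀)))) refl α β γ c a b t a₀ b₀ t₀ ⟩
        (α *F (q ⟨ a , b , [ t ] ⟩ -F q ⟨ a₀ , b₀ , [ t₀ ] ⟩)) -F (b *F (lin ⟨ α , β , [ γ ] ⟩ ⟨ a , b , [ t ] ⟩ -F lin ⟨ α , β , [ γ ] ⟩ ⟨ a₀ , b₀ , [ t₀ ] ⟩))
          ≡⟨ cong₂ (λ d e → (α *F d) -F (b *F e)) (x≡y⇒x-y≡0 (trans (proj₁ on) (sym (proj₁ on₀)))) (x≡y⇒x-y≡0 (trans (proj₂ on) (sym (proj₂ on₀)))) ⟩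
        (α *F 0F) -F (b *F 0F)
          ≡⟨ cong₂ _-F_ (zeroʳ α) (zeroʳ b) ⟩
        0F -F 0F
          ≡⟨ -‿inverseʳ 0F ⟩
        0F ∎)
        where
        open ≡-Reasoning
        x = b -F b₀
        y = t -F t₀

      -- The second condition is the chord equation divided by t - t₀, or by b - b₀ for the
      -- direction `nothing`. In this divided form it also makes sense at the base point, where it
      -- says that the direction is tangent.
      HasSlope : Pt 1 → Maybe Carrier → Set
      HasSlope ⟨ a , b , [ t ] ⟩ (just s) = b -F b₀ ≡ s *F (t -F t₀) × (t -F t₀) *F disc s ≡ (A *F s) -F B
      HasSlope ⟨ a , b , [ t ] ⟩ nothing  = t ≡ t₀ × β *F (b -F b₀) ≡ A

      -- The base point is assigned its tangent direction, which no chord has.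
      slope : ∀ x → OnConic x → ∃ (HasSlope x)
      slope ⟨ a , b , [ t ] ⟩ on with t ≟ t₀
      slope ⟨ a , b , [ t ] ⟩ on | no t≢t₀ = just s , x≡sy , x-y≡0⇒x≡y (x*y≡0⇒y≡0 y≢0 (begin
          y *F ((y *F disc s) -F ((A *F s) -F B))
            ≡⟨ solve 8 (λ α β γ c A B s y → y :* (y :* (β :* s :* s :+ γ :* s :+ α :* c) :- (A :* s :- B))
                 := (β :* (s :* y) :* (s :* y) :+ γ :* (s :* y) :* y :+ α :* c :* y :* y) :- (A :* (s :* y) :- B :* y)) refl α β γ c A B s y ⟩
          (β *F (s *F y) *F (s *F y) + γ *F (s *F y) *F y + α *F c *F y *F y) -F ((A *F (s *F y)) -F (B *F y))
            ≡⟨ cong (λ e → (β *F e *F e + γ *F e *F y + α *F c *F y *F y) -F ((A *F e) -F (B *F y))) (sym x≡sy) ⟩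
          (β *F x *F x + γ *F x *F y + α *F c *F y *F y) -F ((A *F x) -F (B *F y))
            ≡⟨ x≡y⇒x-y≡0 (sym (chord a b t on)) ⟩
          0F ∎))
        where
        open ≡-Reasoning
        x = b -F b₀
        y = t -F t₀
        y≢0 : y ≢ 0F
        y≢0 = t≢t₀ ∘ x-y≡0⇒x≡y
        y⁻¹ = proj₁ (inverse y y≢0)
        s = x *F y⁻¹
        x≡sy : x ≡ s *F y
        x≡sy = sym (trans (solve 3 (λ x i y → x :* i :* y := (y :* i) :* x) refl x y⁻¹ y)
          (trans (cong (_*F x) (proj₂ (inverse y y≢0))) (*-identityˡ x)))
      slope ⟨ a , b , [ t ] ⟩ on | yes refl with b ≟ b₀
      slope ⟨ a , b , [ t ] ⟩ on | yes refl | no b≢b₀ = nothing , refl , x-y≡0⇒x≡y (x*y≡0⇒y≡0 x≢0 (begin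
          x *F ((β *F x) -F A)
            ≡⟨ solve 7 (λ α β γ c A B x → x :* (β :* x :- A) :=
                (β :* x :* x :+ γ :* x :* con 0ℤ :+ α :* c :* con 0ℤ :* con 0ℤ) :- (A :* x :- B :* con 0ℤ)) refl α β γ c A B x ⟩
          (β *F x *F x + γ *F x *F 0F + α *F c *F 0F *F 0F) -F ((A *F x) -F (B *F 0F))
            ≡⟨ cong (λ y → (β *F x *F x + γ *F x *F y + α *F c *F y *F y) -F ((A *F x) -F (B *F y))) (sym (-‿inverseʳ t)) ⟩
          (β *F x *F x + γ *F x *F (t -F t) + α *F c *F (t -F t) *F (t -F t)) -F ((A *F x) -F (B *F (t -F t)))
            ≡⟨ x≡y⇒x-y≡0 (sym (chord a b t on)) ⟩
          0F ∎))
        where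
        open ≡-Reasoning
        x = b -F b₀
        x≢0 : x ≢ 0F
        x≢0 = b≢b₀ ∘ x-y≡0⇒x≡y
      slope ⟨ a , b , [ t ] ⟩ on | yes refl | yes refl with A ≟ 0F
      ... | yes A≡0 = nothing , refl , trans (trans (cong (β *F_) (-‿inverseʳ b)) (zeroʳ β)) (sym A≡0)
      ... | no A≢0 with A⁻¹ , AA⁻¹≡1 ← inverse A A≢0 = just (B *F A⁻¹) ,
        trans (-‿inverseʳ b) (sym (trans (cong (B *F A⁻¹ *F_) (-‿inverseʳ t)) (zeroʳ _))) ,
        trans (trans (cong (_*F disc (B *F A⁻¹)) (-‿inverseʳ t)) (zeroˡ _))
          (sym (x≡y⇒x-y≡0 (trans (solve 3 (λ A B i → A :* (B :* i) :=
              (A :* i) :* B) refl A B A⁻¹) (trans (cong (_*F B) AA⁻¹≡1) (*-identityˡ B)))))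

      -- The equation for t - t₀ has leading coefficient `disc s`. Two different solutions force
      -- that coefficient and the right side to vanish, which `no-line` excludes. Then the slope
      -- determines b, and the plane equation a.
      slope-injective : ∀ {x y} s → OnConic x → OnConic y → HasSlope x s → HasSlope y s → x ≡ y
      slope-injective {⟨ a , b , [ t ] ⟩} {⟨ a′ , b′ , [ t′ ] ⟩} s on on′ h h′ = ⟨⟩-cong a≡a′ b≡b′ (cong [_] t≡t′)
        where
        open ≡-Reasoning
        coordinates : ∀ s → HasSlope ⟨ a , b , [ t ] ⟩ s → HasSlope ⟨ a′ , b′ , [ t′ ] ⟩ s → t ≡ t′ × b ≡ b′
        coordinates nothing (refl , e) (refl , e′) = refl , x-y≡0⇒x≡y (x*y≡0⇒y≡0 β≢0
          (trans (solve 4 (λ β b b′ b₀ → β :* (b :- b′) :=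
              β :* (b :- b₀) :- β :* (b′ :- b₀)) refl β b b′ b₀) (x≡y⇒x-y≡0 (trans e (sym e′)))))
        coordinates (just s) (e , d) (e′ , d′) with t ≟ t′
        ... | yes refl = refl , x-y≡0⇒x≡y (trans (solve 3 (λ b b′ b₀ → b :- b′ := (b :- b₀) :- (b′ :- b₀)) refl b b′ b₀) (x≡y⇒x-y≡0 (trans e (sym e′))))
        ... | no t≢t′  = contradiction (x-y≡0⇒x≡y As-B≡0) (no-line s disc≡0)
          where
          disc≡0 : disc s ≡ 0F
          disc≡0 = x*y≡0⇒y≡0 (t≢t′ ∘ x-y≡0⇒x≡y)
            (trans (solve 4 (λ t t′ t₀ d → (t :- t′) :* d := (t :- t₀) :* d :- (t′ :- t₀) :* d) refl t t′ t₀ (disc s)) (x≡y⇒x-y≡0 (trans d (sym d′))))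
          As-B≡0 : (A *F s) -F B ≡ 0F
          As-B≡0 = trans (sym d) (trans (cong ((t -F t₀) *F_) disc≡0) (zeroʳ _))
        t≡t′ = proj₁ (coordinates s h h′)
        b≡b′ = proj₂ (coordinates s h h′)
        a≡a′ : a ≡ a′
        a≡a′ = x-y≡0⇒x≡y (x*y≡0⇒y≡0 α≢0 (begin
          α *F (a -F a′)
            ≡⟨ solve 5 (λ α a a′ u v → α :* (a :- a′) :=
                (α :* a :+ (u :+ v)) :- (α :* a′ :+ (u :+ v))) refl α a a′ (β *F b) (γ *F t) ⟩
          (α *F a + (β *F b + γ *F t)) -F (α *F a′ + (β *F b + γ *F t))
            ≡⟨ cong₂ (λ b″ t″ → (α *F a + (β *F b + γ *F t)) -F (α *F a′ + (β *F b″ + γ *F t″))) b≡b′ t≡t′ ⟩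
          (α *F a + (β *F b + γ *F t)) -F (α *F a′ + (β *F b′ + γ *F t′))
            ≡⟨ x≡y⇒x-y≡0 (trans (proj₂ on) (sym (proj₂ on′))) ⟩
          0F ∎))

    slopes : List (Maybe Carrier)
    slopes = nothing ∷ map just elems

    slopes-unique : Unique slopes
    slopes-unique = Allₚ.map⁺ (All.universal (λ _ ()) elems) ∷ Uniqueₚ.map⁺ Maybeₚ.just-injective elems-unique

    slopes-complete : ∀ s → s ∈ slopes
    slopes-complete nothing  = here refl
    slopes-complete (just s) = there (∈-map⁺ just (elems-complete s))

    -- Any point can serve as base point, and the head of the list is taken; an empty section needs
    -- none.
    length-conic : ∀ {xs} → Unique xs → All OnConic xs → length xs ℕ.≤ suc size
    length-conic {[]}                         xs! all = ℕ.z≤n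
    length-conic {⟨ a₀ , b₀ , [ t₀ ] ⟩ ∷ xs} xs! all@(on₀ ∷ _) =
      subst (length (⟨ a₀ , b₀ , [ t₀ ] ⟩ ∷ xs) ℕ.≤_) (cong suc (Listₚ.length-map just elems))
        (length-⊆-image {R = HasSlope} slope slope-injective (Maybeₚ.≡-dec _≟_) slopes-unique slopes-complete all xs!)
      where
      open Slope a₀ b₀ t₀ on₀

    conic-count : joint ⟨ α , β , [ γ ] ⟩ (λ u v → 𝟙 (u ≟ r) ℤ.* 𝟙 (v ≟ k)) ℤ.≤ 1ℤ ℤ.+ n
    conic-count = subst (ℤ._≤ 1ℤ ℤ.+ n)
      (trans (length-filter-∑ onConic? (pts 1)) (∑-cong (pts 1) (λ x → 𝟙-× (q x ≟ r) (lin ⟨ α , β , [ γ ] ⟩ x ≟ k))))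
      (ℤ.+≤+ (length-conic (Uniqueₚ.filter⁺ onConic? (pts-unique 1)) (Allₚ.all-filter onConic? (pts 1))))

  -- Hyperplane sections of spheres.

  indicator : Carrier → Carrier → Carrier → Carrier → ℤ
  indicator r k u v = 𝟙 (u ≟ r) ℤ.* 𝟙 (v ≟ k)

  -- The bound q^{2m-1} + q^{m-1}, multiplied by q so that it makes sense for m = 0.
  SliceBound : ∀ {m} → Carrier → Pt m → Set
  SliceBound {m} r ρ = ∀ k → n ℤ.* joint ρ (indicator r k) ℤ.≤ n ℤ.^ m ℤ.* n ℤ.^ m ℤ.+ n ℤ.^ m

  SliceBound-isometry : ∀ {m r} (ρ ρ′ : Pt m) (π π⁻¹ : Pt m → Pt m) → (∀ x → π⁻¹ (π x) ≡ x) → (∀ x → π (π⁻¹ x) ≡ x) →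
    (∀ x → q (π x) ≡ q x) → (∀ x → lin ρ (π x) ≡ lin ρ′ x) → SliceBound r ρ′ → SliceBound r ρ
  SliceBound-isometry {m} {r} ρ ρ′ π π⁻¹ invˡ invʳ q-inv lin-inv bound k =
    subst (λ e → n ℤ.* e ℤ.≤ n ℤ.^ m ℤ.* n ℤ.^ m ℤ.+ n ℤ.^ m) (sym (joint-isometry {ρ = ρ} {ρ′} π π⁻¹ invˡ invʳ q-inv lin-inv (indicator r k))) (bound k)

  0≤n^ : ∀ m → 0ℤ ℤ.≤ n ℤ.^ m
  0≤n^ zero    = ℤ.+≤+ ℕ.z≤n
  0≤n^ (suc m) = subst (ℤ._≤ n ℤ.^ suc m) (ℤₚ.*-zeroʳ n) (ℤₚ.*-monoˡ-≤-nonNeg n (0≤n^ m))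

  -- The linear form vanishes on the isotropic vector of the coordinate a, so `joint-plane` applies.
  -- Its correction term is a section of the smaller quadric if `ρ` is non-zero and a whole smaller
  -- sphere otherwise.
  sliceBound-degenerate : ∀ {m r} → Elliptic r → (β : Carrier) (ρ : Pt m) → (NonZero ρ → SliceBound r ρ) →
                          NonZero ⟨ 0F , β , ρ ⟩ → SliceBound r ⟨ 0F , β , ρ ⟩
  sliceBound-degenerate _ _ _ _ (inj₁ 0≢0) = contradiction refl 0≢0
  sliceBound-degenerate {m} {r} ell β ρ rec (inj₂ βρ≢0) k = begin
    n ℤ.* joint ⟨ 0F , β , ρ ⟩ (indicator r k)
      ≡⟨ cong (n ℤ.*_) (joint-plane β ρ (indicator r k)) ⟩
    n ℤ.* ((∑[ b ∈ elems ] ∑[ x ∈ pts m ] h (β *F b + lin ρ x)) ℤ.- (∑[ x ∈ pts m ] h (lin ρ x)) ℤ.+ n ℤ.* joint ρ (indicator r k))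
      ≤⟨ cases (nonZero? ρ) βρ≢0 ⟩
    n ℤ.^ suc m ℤ.* n ℤ.^ suc m ℤ.+ n ℤ.^ suc m ∎
    where
    open ℤₚ.≤-Reasoning
    p = n ℤ.^ m
    h : Carrier → ℤ
    h v = ∑[ u ∈ elems ] indicator r k u v
    h≡𝟙 : ∀ v → h v ≡ 𝟙 (v ≟ k)
    h≡𝟙 v = trans (∑-*ʳ elems (λ u → 𝟙 (u ≟ r)) (𝟙 (v ≟ k))) (trans (cong (ℤ._* 𝟙 (v ≟ k)) (∑-𝟙-≟ r)) (ℤₚ.*-identityˡ _))
    ∑h≡1 : ∑ elems h ≡ 1ℤ
    ∑h≡1 = trans (∑-cong elems h≡𝟙) (∑-𝟙-≟ k)
    X = ∑[ b ∈ elems ] ∑[ x ∈ pts m ] h (β *F b + lin ρ x)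
    Y = ∑[ x ∈ pts m ] h (lin ρ x)
    cases : NonZero ρ ⊎ ρ ≡ origin m → β ≢ 0F ⊎ NonZero ρ →
            n ℤ.* (X ℤ.- Y ℤ.+ n ℤ.* joint ρ (indicator r k)) ℤ.≤ n ℤ.^ suc m ℤ.* n ℤ.^ suc m ℤ.+ n ℤ.^ suc m
    -- Both plain sums are equidistributed, and the bound for m then becomes the bound for m + 1
    -- with no loss.
    cases (inj₁ ρ≢0) _ = begin
      n ℤ.* (X ℤ.- Y ℤ.+ n ℤ.* joint ρ (indicator r k))
        ≡⟨ cong₂ (λ i j → n ℤ.* (i ℤ.- j ℤ.+ n ℤ.* joint ρ (indicator r k)))
             (trans (∑-cong elems (λ b → trans (∑-cong (pts m) (λ x → cong h (+-comm (β *F b) (lin ρ x))))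
               (trans (∑-lin ρ ρ≢0 (λ v → h (v + β *F b))) (cong (λ i → p ℤ.* p ℤ.* i) (trans (∑-translate (β *F b) h) ∑h≡1))))) (∑-const elems _))
             (trans (∑-lin ρ ρ≢0 h) (cong (λ i → p ℤ.* p ℤ.* i) ∑h≡1)) ⟩
      n ℤ.* (n ℤ.* (p ℤ.* p ℤ.* 1ℤ) ℤ.- p ℤ.* p ℤ.* 1ℤ ℤ.+ n ℤ.* joint ρ (indicator r k))
        ≡⟨ slice-nonZero n p (joint ρ (indicator r k)) ⟩
      n ℤ.* (n ℤ.* joint ρ (indicator r k)) ℤ.+ (n ℤ.* (n ℤ.* (p ℤ.* p)) ℤ.- n ℤ.* (p ℤ.* p))
        ≤⟨ ℤₚ.+-monoˡ-≤ _ (ℤₚ.*-monoˡ-≤-nonNeg n (rec ρ≢0 k)) ⟩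
      n ℤ.* (p ℤ.* p ℤ.+ p) ℤ.+ (n ℤ.* (n ℤ.* (p ℤ.* p)) ℤ.- n ℤ.* (p ℤ.* p))
        ≡⟨ slice-nonZero-bound n p ⟩
      n ℤ.^ suc m ℤ.* n ℤ.^ suc m ℤ.+ n ℤ.^ suc m ∎
    cases (inj₂ refl) (inj₂ ρ≢0) = contradiction ρ≢0 (origin-zero m)
      where
      origin-zero : ∀ m → ¬ NonZero (origin m)
      origin-zero zero    0≢0                = 0≢0 refl
      origin-zero (suc m) (inj₁ 0≢0)         = 0≢0 refl
      origin-zero (suc m) (inj₂ (inj₁ 0≢0))  = 0≢0 refl
      origin-zero (suc m) (inj₂ (inj₂ ρ≢0))  = origin-zero m ρ≢0
    -- The hyperplane fixes b. If k ≠ 0 then b ≠ 0 and a is determined by the rest; if k = 0 then a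
    -- is free and the section is a cylinder over the smaller sphere, whose deficit gives the
    -- negative term.
    cases (inj₂ refl) (inj₁ β≢0) = begin
      n ℤ.* (X ℤ.- Y ℤ.+ n ℤ.* joint ρ (indicator r k))
        ≡⟨ cong₂ (λ i j → n ℤ.* (i ℤ.+ n ℤ.* j)) (cong₂ ℤ._-_ X≡ Y≡) E≡ ⟩
      n ℤ.* (n ℤ.* (p ℤ.* p) ℤ.- n ℤ.* (p ℤ.* p) ℤ.* e ℤ.+ n ℤ.* ((p ℤ.* p ℤ.- p) ℤ.* e))
        ≡⟨ slice-zero n p e ⟩
      n ℤ.^ suc m ℤ.* n ℤ.^ suc m ℤ.+ n ℤ.^ suc m ℤ.- (n ℤ.^ suc m ℤ.+ n ℤ.^ suc (suc m) ℤ.* e)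
        ≤⟨ ℤₚ.+-monoʳ-≤ (n ℤ.^ suc m ℤ.* n ℤ.^ suc m ℤ.+ n ℤ.^ suc m) (ℤₚ.neg-mono-≤ (ℤₚ.+-mono-≤ (0≤n^ (suc m)) 0≤n²pe)) ⟩
      n ℤ.^ suc m ℤ.* n ℤ.^ suc m ℤ.+ n ℤ.^ suc m ℤ.+ 0ℤ
        ≡⟨ ℤₚ.+-identityʳ _ ⟩
      n ℤ.^ suc m ℤ.* n ℤ.^ suc m ℤ.+ n ℤ.^ suc m ∎
      where
      e = 𝟙 (0F ≟ k)
      0≤n²pe : 0ℤ ℤ.≤ n ℤ.^ suc (suc m) ℤ.* e
      0≤n²pe with 0F ≟ k
      ... | yes _ = subst (0ℤ ℤ.≤_) (sym (ℤₚ.*-identityʳ _)) (0≤n^ (suc (suc m)))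
      ... | no _  = ℤₚ.≤-reflexive (sym (ℤₚ.*-zeroʳ (n ℤ.^ suc (suc m))))
      X≡ : X ≡ n ℤ.* (p ℤ.* p)
      X≡ = trans (∑-swap elems (pts m) _)
        (trans (∑-cong (pts m) (λ x → trans (∑-affine β≢0 (lin ρ x) h) ∑h≡1)) (length-pts m))
      Y≡ : Y ≡ n ℤ.* (p ℤ.* p) ℤ.* e
      Y≡ = trans (∑-cong (pts m) (λ x → trans (cong h (lin-origin x)) (trans (h≡𝟙 0F) (sym (ℤₚ.*-identityˡ e)))))
        (trans (∑-*ʳ (pts m) (λ _ → 1ℤ) e) (cong (ℤ._* e) (length-pts m)))
      E≡ : joint ρ (indicator r k) ≡ (p ℤ.* p ℤ.- p) ℤ.* e
      E≡ = trans (∑-cong (pts m) (λ x → cong (λ v → 𝟙 (q x ≟ r) ℤ.* 𝟙 (v ≟ k)) (lin-origin x)))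
        (trans (∑-*ʳ (pts m) (λ x → 𝟙 (q x ≟ r)) e) (cong (ℤ._* e) (sphere-count m ell)))

  SliceBound-swap : ∀ {m r α β} {ρ : Pt m} → SliceBound r ⟨ β , α , ρ ⟩ → SliceBound r ⟨ α , β , ρ ⟩
  SliceBound-swap {α = α} {β} {ρ} = SliceBound-isometry ⟨ α , β , ρ ⟩ ⟨ β , α , ρ ⟩ flip flip
    (λ { ⟨ _ , _ , _ ⟩ → refl }) (λ { ⟨ _ , _ , _ ⟩ → refl })
    (λ { ⟨ a , b , x ⟩ → cong (_+ q x) (*-comm b a) })
    (λ { ⟨ a , b , x ⟩ → solve 5 (λ α β a b l → α :* b :+ (β :* a :+ l) :=
        β :* a :+ (α :* b :+ l)) refl α β a b (lin ρ x) })
    where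
    flip : ∀ {m} → Pt (suc m) → Pt (suc m)
    flip ⟨ a , b , x ⟩ = ⟨ b , a , x ⟩

  SliceBound-swapPlanes : ∀ {m r α β γ δ} {ρ : Pt m} →
                          SliceBound r ⟨ γ , δ , ⟨ α , β , ρ ⟩ ⟩ → SliceBound r ⟨ α , β , ⟨ γ , δ , ρ ⟩ ⟩
  SliceBound-swapPlanes {α = α} {β} {γ} {δ} {ρ} = SliceBound-isometry ⟨ α , β , ⟨ γ , δ , ρ ⟩ ⟩ ⟨ γ , δ , ⟨ α , β , ρ ⟩ ⟩ π π
    (λ { ⟨ _ , _ , ⟨ _ , _ , _ ⟩ ⟩ → refl }) (λ { ⟨ _ , _ , ⟨ _ , _ , _ ⟩ ⟩ → refl })
    (λ { ⟨ a , b , ⟨ c , d , x ⟩ ⟩ → solve 3 (λ u v w → u :+ (v :+ w) := v :+ (u :+ w)) refl (c *F d) (a *F b) (q x) })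
    (λ { ⟨ a , b , ⟨ c , d , x ⟩ ⟩ → solve 5 (λ s t u v w → s :+ (t :+ (u :+ (v :+ w))) :=
        u :+ (v :+ (s :+ (t :+ w)))) refl
      (α *F c) (β *F d) (γ *F a) (δ *F b) (lin ρ x) })
    where
    π : ∀ {m} → Pt (suc (suc m)) → Pt (suc (suc m))
    π ⟨ a , b , ⟨ c , d , x ⟩ ⟩ = ⟨ c , d , ⟨ a , b , x ⟩ ⟩

  SliceBound-swap₂ : ∀ {m r α β γ δ} {ρ : Pt m} →
                     SliceBound r ⟨ α , β , ⟨ δ , γ , ρ ⟩ ⟩ → SliceBound r ⟨ α , β , ⟨ γ , δ , ρ ⟩ ⟩
  SliceBound-swap₂ {m} {r} = SliceBound-swapPlanes {m} {r} ∘ SliceBound-swap ∘ SliceBound-swapPlanes {m} {r}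

  -- An Eichler transvection mixes two hyperbolic planes: the changes of a b and c d cancel. On the
  -- linear form it trades α against γ at the cost of δ, so s = α/γ clears α.
  SliceBound-eichler : ∀ {m r α β γ δ} {ρ : Pt m} s →
    SliceBound r ⟨ α -F (s *F γ) , β , ⟨ γ , δ + s *F β , ρ ⟩ ⟩ → SliceBound r ⟨ α , β , ⟨ γ , δ , ρ ⟩ ⟩
  SliceBound-eichler {α = α} {β} {γ} {δ} {ρ} s = SliceBound-isometry
    ⟨ α , β , ⟨ γ , δ , ρ ⟩ ⟩ ⟨ α -F (s *F γ) , β , ⟨ γ , δ + s *F β , ρ ⟩ ⟩ (eichler s) (eichler (-F s)) (inv s (-F s) (-‿inverseʳ s)) (inv (-F s) s (-‿inverseˡ s))
    (λ { ⟨ a , b , ⟨ c , d , x ⟩ ⟩ → solve 6 (λ a b c d s w → a :* (b :+ s :* d) :+ ((c :- s :* a) :* d :+ w) :=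
        a :* b :+ (c :* d :+ w)) refl a b c d s (q x) })
    (λ { ⟨ a , b , ⟨ c , d , x ⟩ ⟩ → solve 10 (λ α β γ δ a b c d s w →
      α :* a :+ (β :* (b :+ s :* d) :+ (γ :* (c :- s :* a) :+ (δ :* d :+ w))) :=
      (α :- s :* γ) :* a :+ (β :* b :+ (γ :* c :+ ((δ :+ s :* β) :* d :+ w)))) refl α β γ δ a b c d s (lin ρ x) })
    where
    eichler : ∀ {m} → Carrier → Pt (suc (suc m)) → Pt (suc (suc m))
    eichler s ⟨ a , b , ⟨ c , d , x ⟩ ⟩ = ⟨ a , b + s *F d , ⟨ c -F (s *F a) , d , x ⟩ ⟩
    inv : ∀ {m} s s′ → s + s′ ≡ 0F → (x : Pt (suc (suc m))) → eichler s′ (eichler s x) ≡ x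
    inv s s′ e ⟨ a , b , ⟨ c , d , x ⟩ ⟩ = cong₂ (λ b c → ⟨ a , b , ⟨ c , d , x ⟩ ⟩)
      (trans (solve 4 (λ b s s′ d → (b :+ s :* d) :+ s′ :* d := b :+ (s :+ s′) :* d) refl b s s′ d)
        (trans (cong (λ u → b + u *F d) e) (trans (cong (_+_ b) (zeroˡ d)) (+-identityʳ b))))
      (trans (solve 4 (λ c s s′ a → (c :- s :* a) :- s′ :* a := c :+ (:- (s :+ s′)) :* a) refl c s s′ a)
        (trans (cong (λ u → c + (-F u) *F a) e) (solve 2 (λ c a → c :+ (:- con 0ℤ) :* a := c) refl c a)))

  -- If only one hyperbolic plane is left, the section is a conic; otherwise an isometry makes the linear
  -- form vanish on an isotropic vector of the first plane.
  sliceBound-suc : ∀ {m r} → Elliptic r → ((ρ : Pt m) → NonZero ρ → SliceBound r ρ) →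
                   (ρ : Pt (suc m)) → NonZero ρ → SliceBound r ρ
  sliceBound-suc ell rec ⟨ α , β , ρ ⟩ ≢0 with α ≟ 0F | β ≟ 0F
  sliceBound-suc ell rec ⟨ α , β , ρ ⟩ ≢0 | yes refl | _ = sliceBound-degenerate ell β ρ (rec ρ) ≢0
  sliceBound-suc ell rec ⟨ α , β , ρ ⟩ ≢0 | no α≢0 | yes refl =
    SliceBound-swap (sliceBound-degenerate ell α ρ (rec ρ) (inj₂ (inj₁ α≢0)))
  sliceBound-suc {zero} {r} ell rec ⟨ α , β , [ γ ] ⟩ _ | no α≢0 | no β≢0 = λ k → begin
    n ℤ.* joint ⟨ α , β , [ γ ] ⟩ (indicator r k)          ≤⟨ ℤₚ.*-monoˡ-≤-nonNeg n (Conic.conic-count α≢0 β≢0 ell) ⟩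
    n ℤ.* (1ℤ ℤ.+ n)                              ≡⟨ conic-bound n ⟩
    (n ℤ.* 1ℤ) ℤ.* (n ℤ.* 1ℤ) ℤ.+ n ℤ.* 1ℤ        ∎
    where open ℤₚ.≤-Reasoning
  sliceBound-suc {suc m} {r} ell rec ⟨ α , β , ⟨ γ , δ , ρ ⟩ ⟩ _ | no α≢0 | no β≢0 = cases (γ ≟ 0F) (δ ≟ 0F)
    where
    clear : ∀ {γ δ} → γ ≢ 0F → SliceBound r ⟨ α , β , ⟨ γ , δ , ρ ⟩ ⟩
    clear {γ} {δ} γ≢0 = SliceBound-eichler s (subst (λ α′ → SliceBound r ⟨ α′ , β , ρ′ ⟩) (sym α-sγ≡0)
      (sliceBound-degenerate ell β ρ′ (rec ρ′) (inj₂ (inj₁ β≢0))))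
      where
      γ⁻¹ = proj₁ (inverse γ γ≢0)
      s = α *F γ⁻¹
      ρ′ = ⟨ γ , δ + s *F β , ρ ⟩
      α-sγ≡0 : α -F (s *F γ) ≡ 0F
      α-sγ≡0 = x≡y⇒x-y≡0 (sym (trans (solve 3 (λ α i γ → α :* i :* γ := (γ :* i) :* α) refl α γ⁻¹ γ)
        (trans (cong (_*F α) (proj₂ (inverse γ γ≢0))) (*-identityˡ α))))
    cases : Dec (γ ≡ 0F) → Dec (δ ≡ 0F) → SliceBound r ⟨ α , β , ⟨ γ , δ , ρ ⟩ ⟩
    cases (no γ≢0)   _          = clear γ≢0
    cases (yes _)    (no δ≢0)   = SliceBound-swap₂ {m} {r} (clear δ≢0)
    cases (yes refl) (yes refl) = SliceBound-swapPlanes {m} {r}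
      (sliceBound-degenerate ell 0F ⟨ α , β , ρ ⟩ (rec ⟨ α , β , ρ ⟩) (inj₂ (inj₂ (inj₁ α≢0))))

  sliceBound : ∀ m {r} → Elliptic r → (ρ : Pt m) → NonZero ρ → SliceBound r ρ
  -- On a line the form -c t² never takes the value r, so the sphere itself is empty.
  sliceBound zero {r} ell [ γ ] _ k = subst (ℤ._≤ 1ℤ ℤ.* 1ℤ ℤ.+ 1ℤ) (sym (trans (cong (n ℤ.*_) E≡0) (ℤₚ.*-zeroʳ n))) (ℤ.+≤+ ℕ.z≤n)
    where
    E≡0 : joint [ γ ] (indicator r k) ≡ 0ℤ
    E≡0 = trans (∑-pts-zero (λ x → indicator r k (q x) (lin [ γ ] x)))
      (trans (∑-cong elems (λ t → cong (ℤ._* 𝟙 (lin [ γ ] [ t ] ≟ k)) (𝟙-no (q [ t ] ≟ r) (elliptic⇒-ct²≢r ell t)))) (∑-zero elems))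
  sliceBound (suc m) ell = sliceBound-suc ell (sliceBound m ell)

-- Intersections of spheres, covariances and the discrepancy.

module Incidence (F : FiniteField) (c : FiniteField.Carrier F) (c≢0 : c ≢ FiniteField.0F F)
                 (2≢0 : FiniteField._+_ F (FiniteField.1F F) (FiniteField.1F F) ≢ FiniteField.0F F) where
  open FiniteField F
  open FieldProperties F
  open Points F
  open Quadric F c c≢0

  -- The coefficients of the linear form obtained by fixing w in the polar bilinear form of `q`. Its
  -- last coefficient is -2 c w, so non-degeneracy rests on 2 ≠ 0.
  polar : ∀ {m} → Pt m → Pt m
  polar [ w ]         = [ -F (c *F (w + w)) ]
  polar ⟨ a , b , w ⟩ = ⟨ b , a , polar w ⟩

  polar-nonZero : ∀ {m} (w : Pt m) → NonZero w → NonZero (polar w)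
  polar-nonZero [ w ] w≢0 e = x*y≢0 c≢0 (x*y≢0 2≢0 w≢0)
    (trans (cong (c *F_) (trans (solve 2 (λ i w → (i :+ i) :* w := i :* w :+ i :* w) refl 1F w) (cong₂ _+_ (*-identityˡ w) (*-identityˡ w))))
      (trans (solve 1 (λ x → x := :- (:- x)) refl (c *F (w + w))) (trans (cong -F_ e) (solve 0 (:- con 0ℤ := con 0ℤ) refl))))
  polar-nonZero ⟨ a , b , w ⟩ (inj₁ a≢0)        = inj₂ (inj₁ a≢0)
  polar-nonZero ⟨ a , b , w ⟩ (inj₂ (inj₁ b≢0)) = inj₁ b≢0
  polar-nonZero ⟨ a , b , w ⟩ (inj₂ (inj₂ w≢0)) = inj₂ (inj₂ (polar-nonZero w w≢0))

  q-⊖ : ∀ {m} (x w : Pt m) → q (x ⊖ w) ≡ (q x -F lin (polar w) x) + q w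
  q-⊖ [ x ] [ w ] = solve 3 (λ c x w → :- (c :* ((x :- w) :* (x :- w))) :=
    (:- (c :* (x :* x)) :- (:- (c :* (w :+ w))) :* x) :+ :- (c :* (w :* w))) refl c x w
  q-⊖ ⟨ a , b , x ⟩ ⟨ a′ , b′ , w ⟩ = trans (cong (_+_ ((a -F a′) *F (b -F b′))) (q-⊖ x w))
    (solve 7 (λ a b a′ b′ u v w → (a :- a′) :* (b :- b′) :+ ((u :- v) :+ w) :=
      (a :* b :+ u :- (b′ :* a :+ (a′ :* b :+ v))) :+ (a′ :* b′ :+ w)) refl a b a′ b′ (q x) (lin (polar w) x) (q w))

  on : ∀ {m} → Pt m → Pt m × Carrier → ℤ
  on x (y , r) = 𝟙 (q (x ⊖ y) ≟ r)

  ∑-⊖ : ∀ {m} (y : Pt m) (f : Pt m → ℤ) → ∑[ x ∈ pts m ] f (x ⊖ y) ≡ ∑ (pts m) f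
  ∑-⊖ y = ∑-pts-bijection (_⊖ y) (_⊕ y) (λ x → ⊖-⊕ x y) (λ x → ⊕-⊖ x y)

  sphere-size : ∀ m (s : Pt m × Carrier) → Elliptic (proj₂ s) → ∑[ x ∈ pts m ] on x s ≡ n ℤ.^ m ℤ.* n ℤ.^ m ℤ.- n ℤ.^ m
  sphere-size m (y , r) ell = trans (∑-⊖ y (λ x → 𝟙 (q x ≟ r))) (sphere-count m ell)

  -- The difference of the two sphere equations is linear, so the intersection is a hyperplane section.
  intersection-point : ∀ {m} (x w : Pt m) r r′ →
    𝟙 (q x ≟ r) ℤ.* 𝟙 (q (x ⊖ w) ≟ r′) ≡ indicator r ((r + q w) -F r′) (q x) (lin (polar w) x)
  intersection-point x w r r′ with q x ≟ r
  ... | no _     = refl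
  ... | yes refl = cong (1ℤ ℤ.*_) (𝟙-cong
    (λ e → x-y≡0⇒x≡y (trans (solve 4 (λ l u v r′ → l :- (u :+ v :- r′) :=
        r′ :- ((u :- l) :+ v)) refl (lin (polar w) x) (q x) (q w) r′)
      (x≡y⇒x-y≡0 (trans (sym e) (q-⊖ x w)))))
    (λ e → trans (q-⊖ x w) (trans (cong (λ l → (q x -F l) + q w) e)
      (solve 3 (λ u v r′ → (u :- (u :+ v :- r′)) :+ v := r′) refl (q x) (q w) r′)))
    (q (x ⊖ w) ≟ r′) (lin (polar w) x ≟ ((q x + q w) -F r′)))

  -- Translation moves the first centre to the origin, and w is the other centre. If w = 0 the radii
  -- differ and the spheres are disjoint; otherwise `polar w` is a non-zero form.
  intersection-size : ∀ m (s s′ : Pt m × Carrier) → s ≢ s′ → Elliptic (proj₂ s) →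
    n ℤ.* (∑[ x ∈ pts m ] on x s ℤ.* on x s′) ℤ.≤ n ℤ.^ m ℤ.* n ℤ.^ m ℤ.+ n ℤ.^ m
  intersection-size m (y , r) (y′ , r′) s≢s′ ell with nonZero? (y′ ⊖ y)
  ... | inj₁ w≢0 = subst (λ e → n ℤ.* e ℤ.≤ n ℤ.^ m ℤ.* n ℤ.^ m ℤ.+ n ℤ.^ m) (sym slice)
    (sliceBound m ell (polar w) (polar-nonZero w w≢0) ((r + q w) -F r′))
    where
    w = y′ ⊖ y
    slice : ∑[ x ∈ pts m ] on x (y , r) ℤ.* on x (y′ , r′) ≡ joint (polar w) (indicator r ((r + q w) -F r′))
    slice = trans (∑-cong (pts m) (λ x → cong (λ z → 𝟙 (q (x ⊖ y) ≟ r) ℤ.* 𝟙 (q z ≟ r′)) (sym (⊖-⊖-⊖ x y y′))))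
      (trans (∑-⊖ y (λ x → 𝟙 (q x ≟ r) ℤ.* 𝟙 (q (x ⊖ w) ≟ r′))) (∑-cong (pts m) (λ x → intersection-point x w r r′)))
  ... | inj₂ w≡0 with refl ← ⊖≡origin⇒≡ y′ y w≡0 = subst (ℤ._≤ n ℤ.^ m ℤ.* n ℤ.^ m ℤ.+ n ℤ.^ m)
    (sym (trans (cong (n ℤ.*_) (trans (∑-cong (pts m) disjoint) (∑-zero (pts m)))) (ℤₚ.*-zeroʳ n)))
    (ℤₚ.+-mono-≤ (0≤i² (n ℤ.^ m)) (0≤n^ m))
    where
    disjoint : ∀ x → on x (y′ , r) ℤ.* on x (y′ , r′) ≡ 0ℤ
    disjoint x with q (x ⊖ y′) ≟ r
    ... | no _     = refl
    ... | yes refl = trans (ℤₚ.*-identityˡ _) (𝟙-no (q (x ⊖ y′) ≟ r′) (λ r≡r′ → s≢s′ (cong (y′ ,_) r≡r′)))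

  _≟ₛ_ : ∀ {m} → DecidableEquality (Pt m × Carrier)
  _≟ₛ_ = ≡-dec _≟ₚ_ _≟_

  -- Multiplying the centred indicators by n keeps them integral. The term 3 n p is granted to equal
  -- pairs as well, so that summing over all pairs of spheres simply yields |S|² copies of it.
  covariance : ∀ m (s s′ : Pt m × Carrier) → Elliptic (proj₂ s) → Elliptic (proj₂ s′) → let p = n ℤ.^ m in
    ∑[ x ∈ pts m ] (n ℤ.* on x s ℤ.- 1ℤ) ℤ.* (n ℤ.* on x s′ ℤ.- 1ℤ) ℤ.≤
    𝟙 (s ≟ₛ s′) ℤ.* (n ℤ.* n ℤ.* (p ℤ.* p)) ℤ.+ + 3 ℤ.* (n ℤ.* p)
  covariance m s s′ ell ell′ = begin
    ∑[ x ∈ pts m ] (n ℤ.* on x s ℤ.- 1ℤ) ℤ.* (n ℤ.* on x s′ ℤ.- 1ℤ)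
      ≡⟨ ∑-cong (pts m) (λ x → centred-product n (on x s) (on x s′)) ⟩
    ∑[ x ∈ pts m ] (n ℤ.* n ℤ.* (on x s ℤ.* on x s′) ℤ.+ (1ℤ ℤ.- n ℤ.* (on x s ℤ.+ on x s′)))
      ≡⟨ trans (∑-+ (pts m) (λ x → n ℤ.* n ℤ.* (on x s ℤ.* on x s′)) _)
           (cong₂ ℤ._+_ (∑-*ˡ (pts m) (n ℤ.* n) (λ x → on x s ℤ.* on x s′)) linear) ⟩
    n ℤ.* n ℤ.* (∑[ x ∈ pts m ] on x s ℤ.* on x s′) ℤ.+ L
      ≤⟨ cases (s ≟ₛ s′) ⟩
    𝟙 (s ≟ₛ s′) ℤ.* (n ℤ.* n ℤ.* (p ℤ.* p)) ℤ.+ + 3 ℤ.* (n ℤ.* p) ∎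
    where
    open ℤₚ.≤-Reasoning
    p = n ℤ.^ m
    L = n ℤ.* (p ℤ.* p) ℤ.- n ℤ.* ((p ℤ.* p ℤ.- p) ℤ.+ (p ℤ.* p ℤ.- p))
    linear : ∑[ x ∈ pts m ] (1ℤ ℤ.- n ℤ.* (on x s ℤ.+ on x s′)) ≡ L
    linear = trans (∑-- (pts m) (λ _ → 1ℤ) (λ x → n ℤ.* (on x s ℤ.+ on x s′))) (cong₂ ℤ._-_ (length-pts m)
      (trans (∑-*ˡ (pts m) n (λ x → on x s ℤ.+ on x s′)) (cong (n ℤ.*_) (trans (∑-+ (pts m) (λ x → on x s) (λ x → on x s′))
        (cong₂ ℤ._+_ (sphere-size m s ell) (sphere-size m s′ ell′))))))
    cases : (d : Dec (s ≡ s′)) → n ℤ.* n ℤ.* (∑[ x ∈ pts m ] on x s ℤ.* on x s′) ℤ.+ L ℤ.≤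
            𝟙 d ℤ.* (n ℤ.* n ℤ.* (p ℤ.* p)) ℤ.+ + 3 ℤ.* (n ℤ.* p)
    cases (no s≢s′) = begin
      n ℤ.* n ℤ.* (∑[ x ∈ pts m ] on x s ℤ.* on x s′) ℤ.+ L    ≡⟨ cong (ℤ._+ L) (ℤₚ.*-assoc n n _) ⟩
      n ℤ.* (n ℤ.* (∑[ x ∈ pts m ] on x s ℤ.* on x s′)) ℤ.+ L
        ≤⟨ ℤₚ.+-monoˡ-≤ L (ℤₚ.*-monoˡ-≤-nonNeg n (intersection-size m s s′ s≢s′ ell)) ⟩
      n ℤ.* (p ℤ.* p ℤ.+ p) ℤ.+ L                              ≡⟨ offDiagonal n p ⟩
      + 3 ℤ.* (n ℤ.* p)                                        ≡⟨ sym (ℤₚ.+-identityˡ _) ⟩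
      0ℤ ℤ.+ + 3 ℤ.* (n ℤ.* p)                                 ∎
    cases (yes refl) = begin
      n ℤ.* n ℤ.* (∑[ x ∈ pts m ] on x s ℤ.* on x s) ℤ.+ L     ≡⟨ cong (λ e → n ℤ.* n ℤ.* e ℤ.+ L)
                                                                    (trans (∑-cong (pts m) (λ x → 𝟙-idem (q (x ⊖ proj₁ s) ≟ proj₂ s))) (sphere-size m s ell)) ⟩
      n ℤ.* n ℤ.* (p ℤ.* p ℤ.- p) ℤ.+ L                        ≡⟨ onDiagonal n p ⟩
      n ℤ.* n ℤ.* (p ℤ.* p) ℤ.+ + 3 ℤ.* (n ℤ.* p) ℤ.- (n ℤ.^ suc (suc m) ℤ.+ (n ℤ.* (p ℤ.* p) ℤ.+ n ℤ.^ suc m))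
        ≤⟨ ℤₚ.+-monoʳ-≤ (n ℤ.* n ℤ.* (p ℤ.* p) ℤ.+ + 3 ℤ.* (n ℤ.* p))
             (ℤₚ.neg-mono-≤ (ℤₚ.+-mono-≤ (0≤n^ (suc (suc m))) (ℤₚ.+-mono-≤ 0≤np² (0≤n^ (suc m))))) ⟩
      n ℤ.* n ℤ.* (p ℤ.* p) ℤ.+ + 3 ℤ.* (n ℤ.* p) ℤ.+ 0ℤ       ≡⟨ ℤₚ.+-identityʳ _ ⟩
      n ℤ.* n ℤ.* (p ℤ.* p) ℤ.+ + 3 ℤ.* (n ℤ.* p)
        ≡⟨ cong (ℤ._+ + 3 ℤ.* (n ℤ.* p)) (sym (ℤₚ.*-identityˡ (n ℤ.* n ℤ.* (p ℤ.* p)))) ⟩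
      1ℤ ℤ.* (n ℤ.* n ℤ.* (p ℤ.* p)) ℤ.+ + 3 ℤ.* (n ℤ.* p)     ∎
      where
      0≤np² : 0ℤ ℤ.≤ n ℤ.* (p ℤ.* p)
      0≤np² = subst (ℤ._≤ n ℤ.* (p ℤ.* p)) (ℤₚ.*-zeroʳ n) (ℤₚ.*-monoˡ-≤-nonNeg n (0≤i² p))

  -- Without denominators, D is the sum over `P` of the centred incidence counts, so its square is
  -- bounded by |P| times a sum of squares, which expands into covariances.
  incidence-discrepancy : ∀ m (P : List (Pt m)) → Unique P → (S : List (Pt m × Carrier)) → Unique S →
    (∀ s → s ∈ S → Elliptic (proj₂ s)) →
    let D = n ℤ.* (∑[ x ∈ P ] ∑[ s ∈ S ] on x s) ℤ.- + (length P ℕ.* length S)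
        p = n ℤ.^ m; ∣P∣ = + length P; ∣S∣ = + length S in
    D ℤ.* D ℤ.≤ n ℤ.* (n ℤ.* (p ℤ.* p ℤ.* ∣P∣ ℤ.* ∣S∣)) ℤ.+ n ℤ.* (+ 3 ℤ.* p ℤ.* ∣P∣ ℤ.* (∣S∣ ℤ.* ∣S∣))
  incidence-discrepancy m P P! S S! ell = begin
    D ℤ.* D                          ≡⟨ cong₂ ℤ._*_ D≡ D≡ ⟩
    ∑ P g ℤ.* ∑ P g                  ≤⟨ cauchySchwarz P g ⟩
    ∣P∣ ℤ.* (∑[ x ∈ P ] g x ℤ.* g x)
      -- The covariances are known only over the whole space; squares being non-negative, `P` may be
      -- enlarged to all points.
      ≤⟨ ℤₚ.*-monoˡ-≤-nonNeg ∣P∣ (∑-⊆ _≟ₚ_ (pts-unique m) pts-complete P! (λ x → g x ℤ.* g x) (λ x → 0≤i² (g x))) ⟩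
    ∣P∣ ℤ.* (∑[ x ∈ pts m ] g x ℤ.* g x)
      ≡⟨ cong (∣P∣ ℤ.*_) (trans (∑-cong (pts m) (λ x → ∑-*-∑ S S (λ s → n ℤ.* on x s ℤ.- 1ℤ) (λ s → n ℤ.* on x s ℤ.- 1ℤ)))
           (trans (∑-swap (pts m) S _) (∑-cong S (λ s → ∑-swap (pts m) S _)))) ⟩
    ∣P∣ ℤ.* (∑[ s ∈ S ] ∑[ s′ ∈ S ] ∑[ x ∈ pts m ] (n ℤ.* on x s ℤ.- 1ℤ) ℤ.* (n ℤ.* on x s′ ℤ.- 1ℤ))
      ≤⟨ ℤₚ.*-monoˡ-≤-nonNeg ∣P∣ (∑-mono-∈ S (λ s s∈ → ∑-mono-∈ S (λ s′ s′∈ → covariance m s s′ (ell s s∈) (ell s′ s′∈)))) ⟩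
    ∣P∣ ℤ.* (∑[ s ∈ S ] ∑[ s′ ∈ S ] (𝟙 (s ≟ₛ s′) ℤ.* (n ℤ.* n ℤ.* (p ℤ.* p)) ℤ.+ + 3 ℤ.* (n ℤ.* p)))
      ≡⟨ cong (∣P∣ ℤ.*_) (trans (∑-cong S (λ s → trans (∑-+ S (λ s′ → 𝟙 (s ≟ₛ s′) ℤ.* N) (λ _ → + 3 ℤ.* (n ℤ.* p)))
             (cong₂ ℤ._+_ (∑-*ʳ S (λ s′ → 𝟙 (s ≟ₛ s′)) N) (∑-const S _))))
           (trans (∑-+ S (λ s → ∑ S (λ s′ → 𝟙 (s ≟ₛ s′)) ℤ.* N) (λ _ → ∣S∣ ℤ.* (+ 3 ℤ.* (n ℤ.* p))))
             (cong₂ ℤ._+_ (∑-*ʳ S (λ s → ∑ S (λ s′ → 𝟙 (s ≟ₛ s′))) N) (∑-const S _)))) ⟩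
    ∣P∣ ℤ.* ((∑[ s ∈ S ] ∑[ s′ ∈ S ] 𝟙 (s ≟ₛ s′)) ℤ.* N ℤ.+ ∣S∣ ℤ.* (∣S∣ ℤ.* (+ 3 ℤ.* (n ℤ.* p))))
      ≤⟨ ℤₚ.*-monoˡ-≤-nonNeg ∣P∣ (ℤₚ.+-monoˡ-≤ (∣S∣ ℤ.* (∣S∣ ℤ.* (+ 3 ℤ.* (n ℤ.* p)))) (ℤₚ.*-monoʳ-≤-nonNeg N {{ℤ.nonNegative 0≤N}} (diagonal _≟ₛ_ S!))) ⟩
    ∣P∣ ℤ.* (∣S∣ ℤ.* N ℤ.+ ∣S∣ ℤ.* (∣S∣ ℤ.* (+ 3 ℤ.* (n ℤ.* p))))
      ≡⟨ variance-total n p ∣P∣ ∣S∣ ⟩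
    n ℤ.* (n ℤ.* (p ℤ.* p ℤ.* ∣P∣ ℤ.* ∣S∣)) ℤ.+ n ℤ.* (+ 3 ℤ.* p ℤ.* ∣P∣ ℤ.* (∣S∣ ℤ.* ∣S∣)) ∎
    where
    open ℤₚ.≤-Reasoning
    p = n ℤ.^ m
    N = n ℤ.* n ℤ.* (p ℤ.* p)
    ∣P∣ = + length P
    ∣S∣ = + length S
    D = n ℤ.* (∑[ x ∈ P ] ∑[ s ∈ S ] on x s) ℤ.- + (length P ℕ.* length S)
    g : Pt m → ℤ
    g x = ∑[ s ∈ S ] (n ℤ.* on x s ℤ.- 1ℤ)
    0≤N : 0ℤ ℤ.≤ N
    0≤N = subst (ℤ._≤ N) (ℤₚ.*-zeroʳ (n ℤ.* n)) (ℤₚ.*-monoˡ-≤-nonNeg (n ℤ.* n) {{ℤ.nonNegative (0≤i² n)}} (0≤i² p))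
    D≡ : D ≡ ∑ P g
    D≡ = sym (trans (∑-cong P (λ x → trans (∑-- S (λ s → n ℤ.* on x s) (λ _ → 1ℤ))
        (cong₂ ℤ._-_ (∑-*ˡ S n (on x)) (trans (∑-const S 1ℤ) (ℤₚ.*-identityʳ ∣S∣)))))
      (trans (∑-- P (λ x → n ℤ.* ∑ S (on x)) (λ _ → ∣S∣))
        (cong₂ ℤ._-_ (∑-*ˡ P n (λ x → ∑ S (on x))) (trans (∑-const P ∣S∣) (sym (ℤₚ.pos-* (length P) (length S)))))))

-- From coordinate vectors to points.

module Coordinates (F : FiniteField) (c : FiniteField.Carrier F) (c≢0 : c ≢ FiniteField.0F F) where
  open FiniteField F
  open FieldProperties F
  open Points F
  open Quadric F c c≢0

  -- The length 2(m + 1) does not reduce to two successors over 2m. This relation exposes them, so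
  -- that vectors can be taken apart two coordinates at a time.
  data Double : ℕ → ℕ → Set where
    zero : Double 0 0
    suc  : ∀ {m k} → Double m k → Double (suc m) (suc (suc k))

  double : ∀ m → Double m (2 ℕ.* m)
  double zero    = zero
  double (suc m) = subst (Double (suc m)) (cong suc (sym (ℕₚ.+-suc m (m ℕ.+ 0)))) (suc (double m))

  encode : ∀ {m k} → Double m k → Vec Carrier (suc k) → Pt m
  encode zero    (t ∷ [])    = [ t ]
  encode (suc d) (a ∷ b ∷ x) = ⟨ a , b , encode d x ⟩

  encode-injective : ∀ {m k} (d : Double m k) {x y} → encode d x ≡ encode d y → x ≡ y
  encode-injective zero    {t ∷ []}    {_ ∷ []}    refl = refl
  encode-injective (suc d) {a ∷ b ∷ x} {_ ∷ _ ∷ y} e with refl , refl , e′ ← ⟨⟩-injective e =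
    cong (λ z → a ∷ b ∷ z) (encode-injective d e′)

  encode--V : ∀ {m k} (d : Double m k) x y → encode d (x -V y) ≡ encode d x ⊖ encode d y
  encode--V zero    (t ∷ [])    (t′ ∷ [])     = refl
  encode--V (suc d) (a ∷ b ∷ x) (a′ ∷ b′ ∷ y) = cong ⟨ a -F a′ , b -F b′ ,_⟩ (encode--V d x y)

  hyp-encode : ∀ {m k} (d : Double m k) x →
               hyp (toList (init x)) -F (c *F (last x *F last x)) ≡ q (encode d x)
  hyp-encode zero    (t ∷ [])    = +-identityˡ _
  hyp-encode (suc d) (a ∷ b ∷ x) = trans (+-assoc (a *F b) _ _) (cong (_+_ (a *F b)) (hyp-encode d x))

+size^m : ∀ s m → + (s ℕ.^ m) ≡ (+ s) ℤ.^ m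
+size^m s zero    = refl
+size^m s (suc m) = trans (ℤₚ.pos-* s (s ℕ.^ m)) (cong (+ s ℤ.*_) (+size^m s m))

-- The radius condition in terms of the quadratic character.

module _ (F : FiniteField) where
  open FiniteField F
  open FieldProperties F

  coefficient : Carrier → QIndex → Carrier
  coefficient ε i3 = 1F
  coefficient ε i4 = ε

  coefficient≢0 : ∀ {ε} → η ε ≡ -[1+ 0 ] → ∀ i → coefficient ε i ≢ 0F
  coefficient≢0 ηε i3 = 0≢1 ∘ sym
  coefficient≢0 ηε i4 = η≡-1⇒≢0 ηε

  Q-coefficient : ∀ ε i m (x : Vec Carrier (suc (2 ℕ.* m))) → let c = coefficient ε i in
                  Q F ε i {m} x ≡ hyp (toList (init x)) -F (c *F (last x *F last x))
  Q-coefficient ε i3 m x = cong (_-F_ (hyp (toList (init x)))) (sym (*-identityˡ _))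
  Q-coefficient ε i4 m x = refl

  -- For `i3` a zero would make -r the square t². For `i4`, -r is a square y², and a zero gives y² =
  -- ε t² with t ≠ 0 because r ≠ 0, so ε would be the square of y/t.
  elliptic : ∀ {ε} (ηε : η ε ≡ -[1+ 0 ]) i {r} → r ≢ 0F → signI F i ℤ.* η (-F r) ≡ -[1+ 0 ] →
             Quadric.Elliptic F (coefficient ε i) (coefficient≢0 ηε i) r
  elliptic ηε i3 {r} _ ηr t e = η≡-1⇒nonSquare (trans (sym (ℤₚ.*-identityˡ _)) ηr) t (x-y≡0⇒x≡y
    (trans (solve 2 (λ r u → u :- (:- r) :=
        r :+ u) refl r (t *F t)) (trans (cong (_+_ r) (sym (*-identityˡ (t *F t)))) e)))
  elliptic {ε} ηε i4 {r} r≢0 ηr t e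
    with y , yy≡-r ← η≡1⇒square {x = -F r} (ℤₚ.neg-injective (trans (sym (ℤₚ.-1*i≡-i _)) ηr)) = ε-square (t ≟ 0F)
    where
    open ≡-Reasoning
    yy≡εtt : y *F y ≡ ε *F (t *F t)
    yy≡εtt = trans yy≡-r (sym (x-y≡0⇒x≡y (trans (solve 2 (λ r u → u :- (:- r) := r :+ u) refl r (ε *F (t *F t))) e)))
    ε-square : Dec (t ≡ 0F) → ⊥
    ε-square (yes refl) = r≢0 (trans (solve 2 (λ r ε → r := r :+ ε :* (con 0ℤ :* con 0ℤ)) refl r ε) e)
    ε-square (no t≢0) with t⁻¹ , tt⁻¹≡1 ← inverse t t≢0 = η≡-1⇒nonSquare ηε (y *F t⁻¹) (begin
      (y *F t⁻¹) *F (y *F t⁻¹)            ≡⟨ solve 2 (λ y i → (y :* i) :* (y :* i) := (y :* y) :* (i :* i)) refl y t⁻¹ ⟩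
      (y *F y) *F (t⁻¹ *F t⁻¹)            ≡⟨ cong (_*F (t⁻¹ *F t⁻¹)) yy≡εtt ⟩
      (ε *F (t *F t)) *F (t⁻¹ *F t⁻¹)
        ≡⟨ solve 3 (λ ε t i → (ε :* (t :* t)) :* (i :* i) := (t :* i) :* ((t :* i) :* ε)) refl ε t t⁻¹ ⟩
      (t *F t⁻¹) *F ((t *F t⁻¹) *F ε)     ≡⟨ cong (λ z → z *F (z *F ε)) tt⁻¹≡1 ⟩
      1F *F (1F *F ε)                     ≡⟨ trans (*-identityˡ _) (*-identityˡ ε) ⟩
      ε                                   ∎)

open import Data.Nat using (_%_; _*_; _^_)
open import Data.Rational using (_/_; _≤_; ∣_∣)

-- With d = 2m + 1 the quotient 3 q^m / q is the square of √3 q^((d-3)/4). Writing it as a quotient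
-- covers d = 1, where the exponent of q is negative.
theorem1p9 : (F : FiniteField) → let open FiniteField F in
    size % 2 ≡ 1 →
    (ε : Carrier) → η ε ≡ -[1+ 0 ] →
    (m : ℕ) (i : QIndex) →
    (R : Carrier → Set) →
    (∀ r → R r → r ≢ 0F) →
    (∀ r → R r → signI F i ℤ.* η (-F r) ≡ -[1+ 0 ]) →
    (P : List (Vec Carrier (suc (2 * m)))) → Unique P →
    (S : List (Sphere F m)) → Unique S →
    (∀ s → s ∈ S → R (proj₂ s)) →
    (σ τ : ℚ) → 0ℚ ≤ σ → 0ℚ ≤ τ →
    (+ (size ^ (2 * m) * length P * length S)) / 1 ≤ σ ℚ.* σ →
    (+ (3 * size ^ m * length P * (length S * length S))) / size ≤ τ ℚ.* τ →
    ∣ (+ incidences F ε i m P S) / 1 ℚ.- (+ (length P * length S)) / size ∣ ≤ σ ℚ.+ τ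
theorem1p9 F _ ε ηε m i R R≢0 Rη P P! S S! S∈R σ τ 0≤σ 0≤τ hσ hτ =
  discrepancy-bound size (+ incidences F ε i m P S) (+ (length P * length S))
    (+ (size ^ (2 * m) * length P * length S)) (+ (3 * size ^ m * length P * (length S * length S)))
    σ τ 0≤σ 0≤τ D²≤ hσ hτ
  where
  open FiniteField F
  open FieldProperties F
  open Points F
  c = coefficient F ε i
  c≢0 = coefficient≢0 F ηε i
  open Quadric F c c≢0
  open Incidence F c c≢0 (nonSquare⇒2≢0 (η≡-1⇒nonSquare ηε))
  open Coordinates F c c≢0

  toPt : Vec Carrier (suc (2 * m)) → Pt m
  toPt = encode (double m)

  sphere : Sphere F m → Pt m × Carrier
  sphere (y , r) = toPt y , r

  sphere-injective : ∀ {s t} → sphere s ≡ sphere t → s ≡ t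
  sphere-injective e with e₁ , e₂ ← ,-injective e = cong₂ _,_ (encode-injective (double m) e₁) e₂

  Q≡q : ∀ x y → Q F ε i {m} (x -V y) ≡ q (toPt x ⊖ toPt y)
  Q≡q x y = trans (Q-coefficient F ε i m (x -V y)) (trans (hyp-encode (double m) (x -V y)) (cong q (encode--V (double m) x y)))

  incidences≡∑ : + incidences F ε i m P S ≡ ∑[ x ∈ map toPt P ] ∑[ s ∈ map sphere S ] on x s
  incidences≡∑ = trans (length-filter-∑ _ (cartesianProduct P S)) (trans (∑-cartesianProduct P S _)
    (trans (∑-cong P (λ x → trans
        (∑-cong S (λ (y , r) → 𝟙-cong (trans (sym (Q≡q x y))) (trans (Q≡q x y)) _ (q (toPt x ⊖ toPt y) ≟ r)))
        (sym (∑-map sphere S (on (toPt x))))))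
      (sym (∑-map toPt P (λ x → ∑ (map sphere S) (on x))))))

  elliptic-S : ∀ s → s ∈ map sphere S → Elliptic (proj₂ s)
  elliptic-S s s∈ with s′ , s′∈S , refl ← ∈-map⁻ sphere s∈ =
    elliptic F ηε i (R≢0 _ (S∈R s′ s′∈S)) (Rη _ (S∈R s′ s′∈S))

  pow : + (size ^ (2 * m)) ≡ n ℤ.^ m ℤ.* n ℤ.^ m
  pow = trans (cong +_ (trans (cong (size ^_) (cong (ℕ._+_ m) (ℕₚ.+-identityʳ m))) (ℕₚ.^-distribˡ-+-* size m m)))
    (trans (ℤₚ.pos-* (size ^ m) (size ^ m)) (cong₂ ℤ._*_ (+size^m size m) (+size^m size m)))

  D²≤ : let D = + size ℤ.* + incidences F ε i m P S ℤ.- + (length P * length S) in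
        D ℤ.* D ℤ.≤ + size ℤ.* (+ size ℤ.* + (size ^ (2 * m) * length P * length S)) ℤ.+
                    + size ℤ.* + (3 * size ^ m * length P * (length S * length S))
  D²≤ = subst₂ ℤ._≤_ (cong₂ (λ I N → (n ℤ.* I ℤ.- N) ℤ.* (n ℤ.* I ℤ.- N)) (sym incidences≡∑) (cong₂ (λ k l → + (k * l)) |P| |S|))
    (cong₂ (λ a b → n ℤ.* (n ℤ.* a) ℤ.+ n ℤ.* b) (sym a≡) (sym b≡))
    (incidence-discrepancy m (map toPt P) (Uniqueₚ.map⁺ (encode-injective (double m)) P!)
      (map sphere S) (Uniqueₚ.map⁺ sphere-injective S!) elliptic-S)
    where
    |P| = Listₚ.length-map toPt P
    |S| = Listₚ.length-map sphere S
    ∣P∣ = + length (map toPt P)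
    ∣S∣ = + length (map sphere S)
    a≡ : + (size ^ (2 * m) * length P * length S) ≡ n ℤ.^ m ℤ.* n ℤ.^ m ℤ.* ∣P∣ ℤ.* ∣S∣
    a≡ = trans (ℤₚ.pos-* (size ^ (2 * m) * length P) (length S)) (cong₂ ℤ._*_
      (trans (ℤₚ.pos-* (size ^ (2 * m)) (length P)) (cong₂ ℤ._*_ pow (cong +_ (sym |P|)))) (cong +_ (sym |S|)))
    b≡ : + (3 * size ^ m * length P * (length S * length S)) ≡ + 3 ℤ.* n ℤ.^ m ℤ.* ∣P∣ ℤ.* (∣S∣ ℤ.* ∣S∣)
    b≡ = trans (ℤₚ.pos-* (3 * size ^ m * length P) (length S * length S)) (cong₂ ℤ._*_
      (trans (ℤₚ.pos-* (3 * size ^ m) (length P)) (cong₂ ℤ._*_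
        (trans (ℤₚ.pos-* 3 (size ^ m)) (cong (+ 3 ℤ.*_) (+size^m size m))) (cong +_ (sym |P|))))
      (trans (ℤₚ.pos-* (length S) (length S)) (cong₂ ℤ._*_ (cong +_ (sym |S|)) (cong +_ (sym |S|)))))
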